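{- For $n\ge 0$ define the polynomial $$\widetilde{Q}_n(x_1,x_2,\widetilde{y}_1,y_2,u_1,u_2,\widetilde{v}_1,v_2,\mathbf{w})=\sum_{\sigma\in\mathfrak{S}_n} x_1^{\mathrm{eareccpeak}(\sigma)}x_2^{\mathrm{eareccdfall}(\sigma)}\widetilde{y}_1^{\mathrm{minval}(\sigma)}y_2^{\mathrm{ereccdrise}(\sigma)}u_1^{\mathrm{nrcpeak}(\sigma)}u_2^{\mathrm{nrcdfall}(\sigma)}\widetilde{v}_1^{\mathrm{nminval}(\sigma)}v_2^{\mathrm{nrcdrise}(\sigma)}\prod_{i\ \text{fixed point of}\ \sigma} w_{\mathrm{psnest}(i,\sigma)}$$ in the indeterminates $x_1,x_2,\widetilde{y}_1,y_2,u_1,u_2,\widetilde{v}_1,v_2$ and $\mathbf{w}=(w_k)_{k\ge0}$. Then, as formal power series in $t$, $$\sum_{n\ge0}\widetilde{Q}_n\,t^n=\cfrac{1}{1-\gamma_0t-\cfrac{\beta_1t^2}{1-\gamma_1t-\cfrac{\beta_2t^2}{1-\gamma_2t-\cdots}}}$$ with $\gamma_0=w_0$, $\gamma_n=[x_2+(n-1)u_2]+[y_2+(n-1)v_2]+w_n$ for $n\ge1$, and $\beta_n=[x_1+(n-1)u_1]\,[\widetilde{y}_1+(n-1)\widetilde{v}_1]$ for $n\ge1$.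
   Context: $\mathfrak{S}_n$ is the set of permutations of $[n]=\{1,\dots,n\}$. For $\sigma\in\mathfrak{S}_n$ and $i\in[n]$: $i$ is a cycle peak if $\sigma^{ -1}(i)<i>\sigma(i)$, a cycle valley if $\sigma^{ -1}(i)>i<\sigma(i)$, a cycle double rise if $\sigma^{ -1}(i)<i<\sigma(i)$, a cycle double fall if $\sigma^{ -1}(i)>i>\sigma(i)$, and a fixed point if $\sigma(i)=i$. An index $i$ is a record if $\sigma(j)<\sigma(i)$ for all $j<i$, and an antirecord if $\sigma(j)>\sigma(i)$ for all $j>i$; an exclusive record is a record that is not an antirecord, an exclusive antirecord is an antirecord that is not a record, and a neither-record-antirecord is an index that is neither. Statistics: eareccpeak = number of cycle peaks that are exclusive antirecords; eareccdfall = number of cycle double falls that are exclusive antirecords; ereccdrise = number of cycle double rises that are exclusive records; nrcpeak, nrcdfall, nrcdrise = numbers of cycle peaks, cycle double falls, cycle double rises (respectively) that are neither-record-antirecords; minval = number of cycle valleys that are the smallest element of their cycle; nminval = number of cycle valleys that are not the smallest element of their cycle. For a fixed point $i$, $\mathrm{psnest}(i,\sigma)=\#\{j<i:\sigma(j)>i\}$. -}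

module Defs where

open import Algebra.Bundles using (CommutativeRing)
open import Data.Nat.Base using (ℕ; zero; suc; _<ᵇ_; _≤ᵇ_; _≡ᵇ_; _∸_)
open import Data.Fin.Base using (Fin; toℕ)
open import Data.Vec.Base using (Vec; []; _∷_; lookup)
open import Data.List.Base using (List; []; _∷_; [_]; map; concatMap; allFin; foldr; length; filterᵇ; upTo)
open import Data.Bool.ListAction using (all; any)
open import Data.Bool.Base using (Bool; true; false; _∧_; _∨_; not; if_then_else_)

-- Permutations of [n], represented (0-based, order-preservingly) as
-- vectors σ : Vec (Fin n) n with σ(i) = lookup σ i.  Such a vector is a
-- permutation iff it is surjective (equivalently bijective).

allVecs : (n m : ℕ) → List (Vec (Fin n) m)
allVecs n zero    = [ [] ]
allVecs n (suc m) = concatMap (λ i → map (i ∷_) (allVecs n m)) (allFin n)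

isPerm : {n : ℕ} → Vec (Fin n) n → Bool
isPerm {n} σ = all (λ i → any (λ j → toℕ (lookup σ j) ≡ᵇ toℕ i) (allFin n)) (allFin n)

perms : (n : ℕ) → List (Vec (Fin n) n)
perms n = filterᵇ isPerm (allVecs n n)

module Stats {n : ℕ} (σ : Vec (Fin n) n) where

  ap : Fin n → ℕ
  ap i = toℕ (lookup σ i)

  inv : Fin n → ℕ
  inv i = foldr (λ j r → if ap j ≡ᵇ toℕ i then toℕ j else r) (toℕ i) (allFin n)

  iter : ℕ → Fin n → Fin n
  iter zero    i = i
  iter (suc k) i = lookup σ (iter k i)

  isFixed isPeak isValley isDRise isDFall : Fin n → Bool
  isFixed  i = ap i ≡ᵇ toℕ i
  isPeak   i = (inv i <ᵇ toℕ i) ∧ (ap i <ᵇ toℕ i)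
  isValley i = (toℕ i <ᵇ inv i) ∧ (toℕ i <ᵇ ap i)
  isDRise  i = (inv i <ᵇ toℕ i) ∧ (toℕ i <ᵇ ap i)
  isDFall  i = (toℕ i <ᵇ inv i) ∧ (ap i <ᵇ toℕ i)

  isCycleMin : Fin n → Bool
  isCycleMin i = all (λ k → toℕ i ≤ᵇ toℕ (iter k i)) (upTo n)

  isRecord isAntirecord : Fin n → Bool
  isRecord     i = all (λ j → not (toℕ j <ᵇ toℕ i) ∨ (ap j <ᵇ ap i)) (allFin n)
  isAntirecord i = all (λ j → not (toℕ i <ᵇ toℕ j) ∨ (ap i <ᵇ ap j)) (allFin n)

  isExclRecord isExclAntirecord isNeither : Fin n → Bool
  isExclRecord     i = isRecord i ∧ not (isAntirecord i)
  isExclAntirecord i = isAntirecord i ∧ not (isRecord i)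
  isNeither        i = not (isRecord i) ∧ not (isAntirecord i)

  count : (Fin n → Bool) → ℕ
  count p = length (filterᵇ p (allFin n))

  eareccpeak eareccdfall ereccdrise nrcpeak nrcdfall nrcdrise minval nminval : ℕ
  eareccpeak  = count (λ i → isPeak i ∧ isExclAntirecord i)
  eareccdfall = count (λ i → isDFall i ∧ isExclAntirecord i)
  ereccdrise  = count (λ i → isDRise i ∧ isExclRecord i)
  nrcpeak     = count (λ i → isPeak i ∧ isNeither i)
  nrcdfall    = count (λ i → isDFall i ∧ isNeither i)
  nrcdrise    = count (λ i → isDRise i ∧ isNeither i)
  minval      = count (λ i → isValley i ∧ isCycleMin i)
  nminval     = count (λ i → isValley i ∧ not (isCycleMin i))

  psnest : Fin n → ℕ
  psnest i = count (λ j → (toℕ j <ᵇ toℕ i) ∧ (toℕ i <ᵇ ap j))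

  fixedPoints : List (Fin n)
  fixedPoints = filterᵇ isFixed (allFin n)

-- Ring-valued part: the polynomial Q̃_n evaluated in an arbitrary
-- commutative ring, and the coefficients of the J-fraction.

module RingDefs {c ℓ} (R : CommutativeRing c ℓ) where
  open CommutativeRing R using (Carrier; _+_; _*_; 0#; 1#)

  pow : Carrier → ℕ → Carrier
  pow x zero    = 1#
  pow x (suc k) = x * pow x k

  natMul : ℕ → Carrier → Carrier
  natMul zero    r = 0#
  natMul (suc m) r = r + natMul m r

  sumL : List Carrier → Carrier
  sumL = foldr _+_ 0#

  prodL : List Carrier → Carrier
  prodL = foldr _*_ 1#

  Qtilde : (x₁ x₂ ỹ₁ y₂ u₁ u₂ ṽ₁ v₂ : Carrier) (w : ℕ → Carrier) → ℕ → Carrier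
  Qtilde x₁ x₂ ỹ₁ y₂ u₁ u₂ ṽ₁ v₂ w n = sumL (map weight (perms n))
    where
    weight : Vec (Fin n) n → Carrier
    weight σ = pow x₁ eareccpeak * pow x₂ eareccdfall * pow ỹ₁ minval * pow y₂ ereccdrise
             * pow u₁ nrcpeak * pow u₂ nrcdfall * pow ṽ₁ nminval * pow v₂ nrcdrise
             * prodL (map (λ i → w (psnest i)) fixedPoints)
      where open Stats σ

  -- Formal power series are coefficient sequences ℕ → Carrier.
  -- The J-fraction 1/(1 - γ₀t - β₁t²/(1 - γ₁t - β₂t²/(1 - …))) is the
  -- series f₀ of the family (f_k) determined by
  --   f_k = 1/(1 - γ_k t - β_{k+1} t² f_{k+1}),
  -- i.e.  f_k = 1 + γ_k t f_k + β_{k+1} t² f_k f_{k+1}.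
  -- T n k m = [t^m] f_k, valid for m ≤ n (computed by recursion on n).

  conv : (ℕ → Carrier) → (ℕ → Carrier) → ℕ → Carrier
  conv a b p = sumL (map (λ i → a i * b (p ∸ i)) (upTo (suc p)))

  module JFrac (γ β : ℕ → Carrier) where
    T : ℕ → ℕ → ℕ → Carrier
    T zero    k m = 1#
    T (suc n) k m = if m ≤ᵇ n then T n k m else new n
      where
      quad : ℕ → Carrier
      quad zero    = 0#
      quad (suc p) = β (suc k) * conv (T n k) (T n (suc k)) p
      new : ℕ → Carrier
      new n' = γ k * T n k n + quad n

    coeff : ℕ → Carrier
    coeff m = T m 0 m

  jfracCoeff : (γ β : ℕ → Carrier) → ℕ → Carrier
  jfracCoeff γ β = JFrac.coeff γ β

  gammaSeq : (x₂ y₂ u₂ v₂ : Carrier) (w : ℕ → Carrier) → ℕ → Carrier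
  gammaSeq x₂ y₂ u₂ v₂ w zero    = w zero
  gammaSeq x₂ y₂ u₂ v₂ w (suc m) = (x₂ + natMul m u₂) + (y₂ + natMul m v₂) + w (suc m)

  -- β_n = [x₁ + (n-1)u₁][ỹ₁ + (n-1)ṽ₁]  (n ≥ 1); β₀ is never used
  betaSeq : (x₁ ỹ₁ u₁ ṽ₁ : Carrier) → ℕ → Carrier
  betaSeq x₁ ỹ₁ u₁ ṽ₁ zero    = 0#
  betaSeq x₁ ỹ₁ u₁ ṽ₁ (suc m) = (x₁ + natMul m u₁) * (ỹ₁ + natMul m ṽ₁)

{-# OPTIONS --safe #-}
-- Build σ by inserting the vertices n, n-1, …, 1 in this order, keeping track of the edges between inserted
-- vertices.  With k open positions and k open values, a new vertex v becomes a fixed point, a cycle peak, a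
-- cycle double rise (choose σ(v)), a cycle double fall (choose σ⁻¹(v)) or a cycle valley (choose both).  A
-- double rise is a record iff σ(v) is the largest open value; σ⁻¹(v) is an antirecord iff it is the largest
-- open position; and a valley is the minimum of its cycle iff it closes the path ending at σ⁻¹(v), that is,
-- iff σ(v) is the start of that path, which is one of the k open values whatever σ⁻¹(v) is.  A fixed point
-- has psnest equal to k.
--
-- The weight of a peak or double fall becomes known only when its image is inserted; the potential, a product
-- over the open positions, anticipates the total of these weights.  The weighted sum over all completions is
-- then the potential times a sum over Motzkin paths from height k, and Flajolet's first-passage decomposition
-- turns the latter into the J-fraction.
module Submission where

open import Defs
open import Algebra.Bundles using (CommutativeRing)
open import Data.Bool.Base using (Bool; true; false; if_then_else_; T; _∧_; _∨_; not)
open import Data.Bool.ListAction using (all; any)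
open import Data.Bool.Properties using (T?; T-∧)
open import Data.Empty using (⊥; ⊥-elim)
open import Data.Fin.Base using (Fin; zero; suc; toℕ; fromℕ<; punchOut)
open import Data.Fin.Properties using (toℕ<n; toℕ-injective; toℕ-fromℕ<; fromℕ<-toℕ; pigeonhole; injective⇒≤; any?; punchOut-injective) renaming (_≟_ to _≟ᶠ_)
open import Data.List.Base using (List; []; _∷_; map; length; _++_; concatMap; allFin; foldr; filterᵇ; upTo)
open import Data.List.Membership.Propositional using (_∈_; _∉_; find; lose)
open import Data.List.Membership.Propositional.Properties using (∈-map⁺; ∈-map⁻; ∈-++⁻; ∈-concatMap⁻; ∈-filter⁺; ∈-filter⁻; ∈-allFin; ∈-upTo⁺)
open import Data.List.Membership.Propositional.Properties.WithK using (unique∧set⇒bag)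
open import Data.List.Properties using (length-map; map-upTo; map-applyUpTo; map-tabulate)
open import Data.List.Relation.Binary.BagAndSetEquality using (∼bag⇒↭)
open import Data.List.Relation.Binary.Permutation.Propositional as ↭ using (_↭_; ↭-sym; ↭-trans; ↭-prep; ↭-swap; ↭-refl)
open import Data.List.Relation.Binary.Permutation.Propositional.Properties using (∈-resp-↭; drop-∷; map⁺; ↭-length; ↭-empty-inv)
open import Data.List.Relation.Unary.All as All using (All; []; _∷_)
import Data.List.Relation.Unary.All.Properties as Allₚ
open import Data.List.Relation.Unary.AllPairs as AllPairs using (AllPairs; []; _∷_)
import Data.List.Relation.Unary.AllPairs.Properties as AllPairsₚ
open import Data.List.Relation.Unary.Any using (here; there)
open import Data.List.Relation.Unary.Any.Properties using (any⁺; any⁻)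
open import Data.List.Relation.Unary.Unique.Propositional using (Unique)
open import Data.List.Relation.Unary.Unique.Propositional.Properties using (allFin⁺) renaming (map⁺ to Unique-map⁺; filter⁺ to Unique-filter⁺)
open import Data.Maybe.Base using (Maybe; just; nothing)
open import Data.Maybe.Properties using (just-injective)
open import Data.Nat.Base using (ℕ; zero; suc; _≤_; _<_; _∸_; z≤n; s≤s; s≤s⁻¹; _≡ᵇ_; _<ᵇ_; _≤ᵇ_)
open import Data.Nat.Induction using (<-rec)
open import Data.Product using (_×_; _,_; proj₁; proj₂; ∃)
open import Data.Sum.Base using (_⊎_; inj₁; inj₂)
open import Data.Vec.Base using (Vec; []; _∷_; lookup; tabulate)
open import Data.Vec.Properties using (lookup∘tabulate; tabulate∘lookup; tabulate-cong)
open import Function.Base using (_∘_; id; const; _$_)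
open import Function.Bundles using (Equivalence; mk⇔)
open import Function.Definitions using (Injective)
open import Relation.Binary.Definitions using (tri<; tri≈; tri>)
open import Relation.Nullary using (yes; no; ¬_)

-- Records and antirecords refer to the linear order, cycle minima to the cycles, and a construction
-- adapted to one tends to hide the other. Decreasing insertion shows both: a vertex below
-- everything inserted so far is the minimum of any cycle that it closes, and the competitors of a
-- rise or of a closing fall are the other open values or positions, whose partners are all still
-- smaller.
--
-- No bijection with labelled paths is built. A restriction is accompanied by the Boolean predicate
-- `P` of the permutations that extend it, a choice adds a conjunct to `P`, and the sum over the
-- fixed list `perms n` splits accordingly. It then suffices that at each permutation the
-- coefficients of the matching choices add up to the factor of the vertex (`ω-choices`), and that a
-- restriction with nothing open has exactly one completion (`leaf`); there it matters that
-- `perms n` lists every permutation once.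

module Combinatorics where
  open import Data.Nat.Base using (_+_)
  open import Data.Nat.Properties
  open import Relation.Binary.PropositionalEquality

  -- Boolean tests as propositions

  T-∧⁺ : ∀ {x y} → T x → T y → T (x ∧ y)
  T-∧⁺ a b = Equivalence.from T-∧ (a , b)

  T-∧⁻ : ∀ {x y} → T (x ∧ y) → T x × T y
  T-∧⁻ = Equivalence.to T-∧

  T-injective : ∀ {x y} → (T x → T y) → (T y → T x) → x ≡ y
  T-injective {true}  {true}  f g = refl
  T-injective {true}  {false} f g = ⊥-elim (f _)
  T-injective {false} {true}  f g = ⊥-elim (g _)
  T-injective {false} {false} f g = refl

  T⇒≡true : ∀ {x} → T x → x ≡ true
  T⇒≡true {true} _ = refl

  ¬T⇒≡false : ∀ {x} → ¬ T x → x ≡ false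
  ¬T⇒≡false {true}  f = ⊥-elim (f _)
  ¬T⇒≡false {false} f = refl

  <ᵇ-true : ∀ {i j} → i < j → (i <ᵇ j) ≡ true
  <ᵇ-true i<j = T⇒≡true (<⇒<ᵇ i<j)

  <ᵇ-false : ∀ {i j} → j ≤ i → (i <ᵇ j) ≡ false
  <ᵇ-false {i} {j} j≤i = ¬T⇒≡false (λ h → <⇒≱ (<ᵇ⇒< i j h) j≤i)

  ≢⇒≡ᵇ-false : ∀ {i j} → i ≢ j → (i ≡ᵇ j) ≡ false
  ≢⇒≡ᵇ-false {i} {j} i≢j = ¬T⇒≡false (i≢j ∘ ≡ᵇ⇒≡ i j)

  T-⇒⁺ : ∀ {a b} → (T a → T b) → T (not a ∨ b)
  T-⇒⁺ {true}  f = f _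
  T-⇒⁺ {false} f = _

  T-⇒⁻ : ∀ {a b} → T (not a ∨ b) → T a → T b
  T-⇒⁻ {true} h _ = h

  -- Lists with one entry taken out

  module _ {A : Set} where

    all⁺ : ∀ (p : A → Bool) xs → (∀ x → x ∈ xs → T (p x)) → T (all p xs)
    all⁺ p xs h = Allₚ.all⁻ p (All.tabulate (h _))

    all⁻ : ∀ (p : A → Bool) {xs x} → T (all p xs) → x ∈ xs → T (p x)
    all⁻ p {xs} h = All.lookup (Allₚ.all⁺ p xs h)

    picks : List A → List (A × List A)
    picks []       = []
    picks (x ∷ xs) = (x , xs) ∷ map (λ (y , ys) → y , x ∷ ys) (picks xs)

    data Pick (x : A) : List A → List A → Set where
      here  : ∀ {xs} → Pick x (x ∷ xs) xs
      there : ∀ {y xs ys} → Pick x xs ys → Pick x (y ∷ xs) (y ∷ ys)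

    ∈-picks⁻ : ∀ xs {x ys} → (x , ys) ∈ picks xs → Pick x xs ys
    ∈-picks⁻ (x ∷ xs) (here refl) = here
    ∈-picks⁻ (x ∷ xs) (there m) with ∈-map⁻ _ m
    ... | _ , m′ , refl = there (∈-picks⁻ xs m′)

    ∈⇒Pick : ∀ {x xs} → x ∈ xs → ∃ λ ys → Pick x xs ys
    ∈⇒Pick (here refl) = _ , here
    ∈⇒Pick (there x∈)  = _ , there (proj₂ (∈⇒Pick x∈))

    Pick-↭ : ∀ {x xs ys} → Pick x xs ys → xs ↭ x ∷ ys
    Pick-↭ here      = ↭-refl
    Pick-↭ (there p) = ↭-trans (↭-prep _ (Pick-↭ p)) (↭-swap _ _ ↭-refl)

    Pick-∈ : ∀ {x xs ys} → Pick x xs ys → x ∈ xs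
    Pick-∈ here      = here refl
    Pick-∈ (there p) = there (Pick-∈ p)

    Pick-⊆ : ∀ {x xs ys y} → Pick x xs ys → y ∈ ys → y ∈ xs
    Pick-⊆ here      y∈          = there y∈
    Pick-⊆ (there p) (here refl) = here refl
    Pick-⊆ (there p) (there y∈)  = there (Pick-⊆ p y∈)

    Pick-split : ∀ {x xs ys y} → Pick x xs ys → y ∈ xs → y ≡ x ⊎ y ∈ ys
    Pick-split here      (here e)    = inj₁ e
    Pick-split here      (there y∈)  = inj₂ y∈
    Pick-split (there p) (here e)    = inj₂ (here e)
    Pick-split (there p) (there y∈) with Pick-split p y∈
    ... | inj₁ e   = inj₁ e
    ... | inj₂ y∈′ = inj₂ (there y∈′)

    Pick-length : ∀ {x xs ys} → Pick x xs ys → length xs ≡ suc (length ys)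
    Pick-length here      = refl
    Pick-length (there p) = cong suc (Pick-length p)

    Pick-All : ∀ {P : A → Set} {x xs ys} → Pick x xs ys → All P xs → All P ys
    Pick-All here      (_ ∷ ps) = ps
    Pick-All (there p) (q ∷ ps) = q ∷ Pick-All p ps

    Pick-AllPairs : ∀ {R : A → A → Set} {x xs ys} → Pick x xs ys → AllPairs R xs → AllPairs R ys
    Pick-AllPairs here      (_ ∷ rs) = rs
    Pick-AllPairs (there p) (r ∷ rs) = Pick-All p r ∷ Pick-AllPairs p rs

    Pick-apart : ∀ {k : A → ℕ} {x xs ys y} → AllPairs (λ a b → k a < k b) xs → Pick x xs ys → y ∈ ys → k y ≢ k x
    Pick-apart (r ∷ _)  here      y∈          = <⇒≢ (All.lookup r y∈) ∘ sym
    Pick-apart (r ∷ _)  (there p) (here refl) = <⇒≢ (All.lookup r (Pick-∈ p))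
    Pick-apart (_ ∷ rs) (there p) (there y∈)  = Pick-apart rs p y∈

  -- Renaming the start of a path

  sub : ℕ → ℕ → ℕ → ℕ
  sub b c x = if x ≡ᵇ b then c else x

  sub-≡ : ∀ b c → sub b c b ≡ c
  sub-≡ b c rewrite T⇒≡true (≡⇒≡ᵇ b b refl) = refl

  sub-≢ : ∀ {b c x} → x ≢ b → sub b c x ≡ x
  sub-≢ {b} {c} {x} x≢b rewrite ¬T⇒≡false (x≢b ∘ ≡ᵇ⇒≡ x b) = refl

  map-sub-∉ : ∀ {b c} xs → b ∉ xs → map (sub b c) xs ≡ xs
  map-sub-∉ []       b∉ = refl
  map-sub-∉ {b} (x ∷ xs) b∉ = cong₂ _∷_ (sub-≢ (λ e → b∉ (here (sym e)))) (map-sub-∉ xs (b∉ ∘ there))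

  sorted⇒Unique : ∀ {xs} → AllPairs _<_ xs → Unique xs
  sorted⇒Unique = AllPairs.map <⇒≢

  -- Joining the path starting at b to the end of the path starting at x.
  relink-↭ : ∀ {x b xs ys} → Unique (b ∷ ys) → x ∷ xs ↭ b ∷ ys → map (sub b x) xs ↭ ys
  relink-↭ {x} {b} {xs} {ys} uniq@(b∉ys ∷ _) perm with x ≟ b
  ... | yes refl rewrite map-sub-∉ {b} {b} xs (λ b∈ → All.lookup b∉ys (∈-resp-↭ (drop-∷ perm) b∈) refl) = drop-∷ perm
  ... | no x≢b with ∈-resp-↭ (↭-sym perm) (here refl)
  ...   | here b≡x = ⊥-elim (x≢b (sym b≡x))
  ...   | there b∈ with ∈⇒Pick b∈
  ...     | zs , pk = ↭-trans (map⁺ (sub b x) (Pick-↭ pk)) (subst (_↭ ys) (cong₂ _∷_ (sym (sub-≡ b x)) (sym (map-sub-∉ zs b∉zs))) x∷zs↭)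
    where
    x∷zs↭ : x ∷ zs ↭ ys
    x∷zs↭ = drop-∷ (↭-trans (↭-swap b x ↭-refl) (↭-trans (↭-prep x (↭-sym (Pick-↭ pk))) perm))
    b∉zs : b ∉ zs
    b∉zs b∈zs = All.lookup b∉ys (∈-resp-↭ x∷zs↭ (there b∈zs)) refl

  -- Permutations as bijections of ℕ, and paths along them

  iterate : (ℕ → ℕ) → ℕ → ℕ → ℕ
  iterate s zero    i = i
  iterate s (suc k) i = s (iterate s k i)

  iterate-suc : ∀ s k i → iterate s (suc k) i ≡ iterate s k (s i)
  iterate-suc s zero    i = refl
  iterate-suc s (suc k) i = cong s (iterate-suc s k i)

  -- A permutation of [n] with the statistics that enter the weight, 0-based.  s and t are mutually inverse
  -- bijections of ℕ, the identity from n on, so that no bound has to be carried along.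
  record View : Set where
    field
      s t            : ℕ → ℕ
      rec anti cmin  : ℕ → Bool
      nest           : ℕ → ℕ

  record Lawful (n : ℕ) (p : View) : Set where
    open View p
    field
      s∘t     : ∀ j → s (t j) ≡ j
      t∘s     : ∀ j → t (s j) ≡ j
      outside : ∀ j → n ≤ j → s j ≡ j
      rec⁺    : ∀ {v} → v < n → (∀ j → j < v → s j < s v) → T (rec v)
      rec⁻    : ∀ {v} → v < n → T (rec v) → ∀ j → j < v → s j < s v
      anti⁺   : ∀ {v} → v < n → (∀ j → v < j → s v < s j) → T (anti v)
      anti⁻   : ∀ {v} → v < n → T (anti v) → ∀ j → v < j → s v < s j
      cmin⁺   : ∀ {v} → v < n → (∀ k → v ≤ iterate s k v) → T (cmin v)
      cmin⁻   : ∀ {v} → v < n → T (cmin v) → ∀ k → v ≤ iterate s k v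
      -- Counts values rather than positions, because the open values of a restriction form such a
      -- list.
      nest-length : ∀ {v} → v < n → ∀ bs → Unique bs → (∀ b → b ∈ bs → v < b × t b < v) →
                    (∀ b → v < b → t b < v → b ∈ bs) → nest v ≡ length bs

    s-injective : ∀ {a b} → s a ≡ s b → a ≡ b
    s-injective {a} {b} e = trans (sym (t∘s a)) (trans (cong t e) (t∘s b))

    t≡⇒ : ∀ {a b} → s a ≡ b → t b ≡ a
    t≡⇒ {a} e = trans (cong t (sym e)) (t∘s a)

    s≡⇒ : ∀ {a b} → t b ≡ a → s a ≡ b
    s≡⇒ {b = b} e = trans (cong s (sym e)) (s∘t b)

  data Path (s : ℕ → ℕ) (i : ℕ) : ℕ → ℕ → Set where
    here : ∀ {a} → i ≤ a → Path s i a a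
    step : ∀ {a b} → i ≤ a → Path s i (s a) b → Path s i a b

  module _ {s : ℕ → ℕ} where

    Path-≥ : ∀ {i a b} → Path s i a b → i ≤ a
    Path-≥ (here i≤a)   = i≤a
    Path-≥ (step i≤a _) = i≤a

    Path-weaken : ∀ {i j a b} → j ≤ i → Path s i a b → Path s j a b
    Path-weaken j≤i (here i≤a)   = here (≤-trans j≤i i≤a)
    Path-weaken j≤i (step i≤a p) = step (≤-trans j≤i i≤a) (Path-weaken j≤i p)

    Path-join : ∀ {i a x b y} → Path s i a x → s x ≡ b → Path s i b y → Path s i a y
    Path-join (here i≤a)   refl q = step i≤a q
    Path-join (step i≤a p) e    q = step i≤a (Path-join p e q)

    Path-iterate : ∀ {i a b} → Path s i a b → ∃ λ k → iterate s k a ≡ b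
    Path-iterate (here _) = 0 , refl
    Path-iterate (step {a} _ p) with Path-iterate p
    ... | k , e = suc k , trans (iterate-suc s k a) e

    -- From `v` the orbit runs along the path, all of whose vertices exceed `v`, and returns to `v`
    -- from its end. The invariant in `orbit` is the part of the path still ahead.
    closed-≥ : ∀ {v a} → Path s (suc v) (s v) a → s a ≡ v → ∀ k → v ≤ iterate s k v
    closed-≥ {v} {a} p e k with orbit k
      where
      orbit : ∀ k → iterate s k v ≡ v ⊎ Path s (suc v) (iterate s k v) a
      orbit zero = inj₁ refl
      orbit (suc k) with orbit k
      ... | inj₁ e′ rewrite e′ = inj₂ p
      ... | inj₂ (here _)   = inj₁ e
      ... | inj₂ (step _ q) = inj₂ q
    ... | inj₁ e′ = ≤-reflexive (sym e′)
    ... | inj₂ q  = <⇒≤ (Path-≥ q)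

  -- Restrictions of a permutation to an upper interval

  -- An open position a ≥ i of σ, i.e. one with σ(a) < i: fall tells whether a is a cycle double fall or a
  -- cycle peak, start is the first vertex of the path of σ in [i, n) that ends at a.
  record Slot : Set where
    constructor slot
    field
      pos   : ℕ
      fall  : Bool
      start : ℕ
  open Slot public

  -- The restriction of σ to [i, n): open positions, open values (those b ≥ i with σ⁻¹(b) < i), known edges.
  record Core : Set where
    constructor core
    field
      op  : List Slot
      ov  : List ℕ
      out : ℕ → Maybe ℕ

  -- Joining the path of a slot to the value `b` puts that path in front of the one starting at `b`,
  -- which therefore takes over its start. If `b` is the start of the joined path itself, a cycle
  -- closes and no remaining slot starts at `b`.
  relink : ℕ → ℕ → Slot → Slot
  relink b c (slot a f x) = slot a f (sub b c x)

  _[_↦_] : (ℕ → Maybe ℕ) → ℕ → ℕ → ℕ → Maybe ℕ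
  (f [ a ↦ b ]) x = if x ≡ᵇ a then just b else f x

  ↦-≡ : ∀ f {a b x} → x ≡ a → (f [ a ↦ b ]) x ≡ just b
  ↦-≡ f {a} refl rewrite T⇒≡true (≡⇒≡ᵇ a a refl) = refl

  ↦-≢ : ∀ f {a b x} → x ≢ a → (f [ a ↦ b ]) x ≡ f x
  ↦-≢ f {a} {b} {x} x≢a rewrite ¬T⇒≡false (x≢a ∘ ≡ᵇ⇒≡ x a) = refl

  ↦-just : ∀ f {a b x c} → (f [ a ↦ b ]) x ≡ just c → (x ≡ a × b ≡ c) ⊎ f x ≡ just c
  ↦-just f {a} {b} {x} e with x ≟ a
  ... | yes x≡a = inj₁ (x≡a , just-injective (trans (sym (↦-≡ f x≡a)) e))
  ... | no  x≢a = inj₂ (trans (sym (↦-≢ f x≢a)) e)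

  map-start-relink : ∀ b c xs → map start (map (relink b c) xs) ≡ map (sub b c) (map start xs)
  map-start-relink b c []       = refl
  map-start-relink b c (x ∷ xs) = cong (_ ∷_) (map-start-relink b c xs)

  add : ℕ → Bool → Core → Core
  add v f (core op ov out) = core (slot v f v ∷ op) (v ∷ ov) out

  join : Slot → List Slot → ℕ → List ℕ → Core → Core
  join x xs b bs (core _ _ out) = core (map (relink b (start x)) xs) bs (out [ pos x ↦ b ])

  record Wf (n i : ℕ) (C : Core) : Set where
    open Core C
    field
      op-sorted : AllPairs (λ x y → pos x < pos y) op
      ov-sorted : AllPairs _<_ ov
      op-≥      : ∀ {x} → x ∈ op → i ≤ pos x
      ov-≥      : ∀ {b} → b ∈ ov → i ≤ b
      op-<n     : ∀ {x} → x ∈ op → pos x < n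
      ov-<n     : ∀ {b} → b ∈ ov → b < n
      -- Each maximal open path begins at an open value and ends at an open position. So the two
      -- kinds are equinumerous, and every slot has one open value that closes its cycle.
      starts    : map start op ↭ ov
      op-out    : ∀ {x} → x ∈ op → out (pos x) ≡ nothing
      out-≥     : ∀ {a b} → out a ≡ just b → i ≤ a × i ≤ b
      out-<n    : ∀ {a b} → out a ≡ just b → a < n × b < n
      out-dom   : ∀ {a} → i ≤ a → a < n → (∃ λ x → x ∈ op × pos x ≡ a) ⊎ (∃ λ b → out a ≡ just b)
      out-cod   : ∀ {b} → i ≤ b → b < n → b ∈ ov ⊎ (∃ λ a → out a ≡ just b)

  add-Wf : ∀ {n v} f {C} → v < n → Wf n (suc v) C → Wf n v (add v f C)
  add-Wf {n} {v} f {C} v<n W = record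
    { op-sorted = All.tabulate op-≥ ∷ op-sorted
    ; ov-sorted = All.tabulate ov-≥ ∷ ov-sorted
    ; op-≥      = λ { (here refl) → ≤-refl ; (there x∈) → <⇒≤ (op-≥ x∈) }
    ; ov-≥      = λ { (here refl) → ≤-refl ; (there x∈) → <⇒≤ (ov-≥ x∈) }
    ; op-<n     = λ { (here refl) → v<n ; (there x∈) → op-<n x∈ }
    ; ov-<n     = λ { (here refl) → v<n ; (there x∈) → ov-<n x∈ }
    ; starts    = ↭-prep v starts
    ; op-out    = λ { (here refl) → out-v ; (there x∈) → op-out x∈ }
    ; out-<n    = out-<n
    ; out-≥     = λ e → <⇒≤ (proj₁ (out-≥ e)) , <⇒≤ (proj₂ (out-≥ e))
    ; out-dom   = dom
    ; out-cod   = cod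
    }
    where
    open Core C
    open Wf W
    out-v : out v ≡ nothing
    out-v with out v in eq
    ... | nothing = refl
    ... | just b  = ⊥-elim (<-irrefl refl (proj₁ (out-≥ eq)))
    dom : ∀ {a} → v ≤ a → a < n → (∃ λ x → x ∈ slot v f v ∷ op × pos x ≡ a) ⊎ (∃ λ b → out a ≡ just b)
    dom v≤a a<n with m≤n⇒m<n∨m≡n v≤a
    ... | inj₂ refl = inj₁ (_ , here refl , refl)
    ... | inj₁ v<a with out-dom v<a a<n
    ...   | inj₁ (x , x∈ , e) = inj₁ (x , there x∈ , e)
    ...   | inj₂ r            = inj₂ r
    cod : ∀ {b} → v ≤ b → b < n → b ∈ v ∷ ov ⊎ (∃ λ a → out a ≡ just b)
    cod v≤b b<n with m≤n⇒m<n∨m≡n v≤b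
    ... | inj₂ refl = inj₁ (here refl)
    ... | inj₁ v<b with out-cod v<b b<n
    ...   | inj₁ b∈ = inj₁ (there b∈)
    ...   | inj₂ r  = inj₂ r

  ∈-relink⁻ : ∀ {b c x xs} → x ∈ map (relink b c) xs → ∃ λ y → y ∈ xs × pos x ≡ pos y × fall x ≡ fall y × start x ≡ sub b c (start y)
  ∈-relink⁻ {b} {c} x∈ with ∈-map⁻ (relink b c) x∈
  ... | y , y∈ , refl = y , y∈ , refl , refl , refl

  join-Wf : ∀ {n i x xs b bs C} → Pick x (Core.op C) xs → Pick b (Core.ov C) bs → Wf n i C → Wf n i (join x xs b bs C)
  join-Wf {n} {i} {x} {xs} {b} {bs} {C} px pb W = record
    { op-sorted = AllPairsₚ.map⁺ (Pick-AllPairs px op-sorted)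
    ; ov-sorted = Pick-AllPairs pb ov-sorted
    ; op-≥      = λ y∈ → let (z , z∈ , e , _) = ∈-relink⁻ y∈ in subst (i ≤_) (sym e) (op-≥ (Pick-⊆ px z∈))
    ; ov-≥      = λ y∈ → ov-≥ (Pick-⊆ pb y∈)
    ; starts    = subst (_↭ bs) (sym (map-start-relink b (start x) xs))
                    (relink-↭ (All.tabulate (λ c∈ e → Pick-apart ov-sorted pb c∈ (sym e)) ∷ sorted⇒Unique (Pick-AllPairs pb ov-sorted))
                      (↭-trans (map⁺ start (↭-sym (Pick-↭ px))) (↭-trans starts (Pick-↭ pb))))
    ; op-out    = λ y∈ → let (z , z∈ , e , _) = ∈-relink⁻ y∈ in
                    subst (λ a → (out [ pos x ↦ b ]) a ≡ nothing) (sym e)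
                      (trans (↦-≢ out (Pick-apart op-sorted px z∈)) (op-out (Pick-⊆ px z∈)))
    ; op-<n     = λ y∈ → let (z , z∈ , e , _) = ∈-relink⁻ y∈ in subst (_< n) (sym e) (op-<n (Pick-⊆ px z∈))
    ; ov-<n     = λ y∈ → ov-<n (Pick-⊆ pb y∈)
    ; out-≥     = ≥
    ; out-<n    = bounded
    ; out-dom   = dom
    ; out-cod   = cod
    }
    where
    open Core C
    open Wf W
    ≥ : ∀ {a c} → (out [ pos x ↦ b ]) a ≡ just c → i ≤ a × i ≤ c
    ≥ e with ↦-just out e
    ... | inj₁ (refl , refl) = op-≥ (Pick-∈ px) , ov-≥ (Pick-∈ pb)
    ... | inj₂ e′            = out-≥ e′
    bounded : ∀ {a c} → (out [ pos x ↦ b ]) a ≡ just c → a < n × c < n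
    bounded e with ↦-just out e
    ... | inj₁ (refl , refl) = op-<n (Pick-∈ px) , ov-<n (Pick-∈ pb)
    ... | inj₂ e′            = out-<n e′
    dom : ∀ {a} → i ≤ a → a < n → (∃ λ y → y ∈ map (relink b (start x)) xs × pos y ≡ a) ⊎ (∃ λ c → (out [ pos x ↦ b ]) a ≡ just c)
    dom {a} i≤a a<n with a ≟ pos x
    ... | yes e = inj₂ (b , ↦-≡ out e)
    ... | no ne with out-dom i≤a a<n
    ...   | inj₂ (c , e) = inj₂ (c , trans (↦-≢ out ne) e)
    ...   | inj₁ (y , y∈ , e) with Pick-split px y∈
    ...     | inj₁ refl = ⊥-elim (ne (sym e))
    ...     | inj₂ y∈′  = inj₁ (_ , ∈-map⁺ (relink b (start x)) y∈′ , e)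
    cod : ∀ {c} → i ≤ c → c < n → c ∈ bs ⊎ (∃ λ a → (out [ pos x ↦ b ]) a ≡ just c)
    cod i≤c c<n with out-cod i≤c c<n
    ... | inj₁ c∈ with Pick-split pb c∈
    ...   | inj₁ refl = inj₂ (pos x , ↦-≡ out refl)
    ...   | inj₂ c∈′  = inj₁ c∈′
    cod i≤c c<n | inj₂ (a , e) = inj₂ (a , trans (↦-≢ out a≢) e)
      where
      a≢ : a ≢ pos x
      a≢ refl with trans (sym e) (op-out (Pick-∈ px))
      ... | ()

  -- Agreement of a restriction with a permutation

  record Sound (i : ℕ) (C : Core) (p : View) : Set where
    open Core C
    open View p
    field
      edge : ∀ {a b} → out a ≡ just b → s a ≡ b
      path : ∀ {x} → x ∈ op → Path s i (start x) (pos x)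
      type : ∀ {x} → x ∈ op → fall x ≡ (pos x <ᵇ t (pos x))

  add-Sound : ∀ {v f C p} → f ≡ (v <ᵇ View.t p v) → Sound (suc v) C p → Sound v (add v f C) p
  add-Sound f≡ S = record
    { edge = edge
    ; path = λ { (here refl) → here ≤-refl ; (there x∈) → Path-weaken (n≤1+n _) (path x∈) }
    ; type = λ { (here refl) → f≡ ; (there x∈) → type x∈ }
    }
    where open Sound S

  join-Sound : ∀ {i x xs b bs C p} → Pick x (Core.op C) xs → View.s p (pos x) ≡ b →
               Sound i C p → Sound i (join x xs b bs C) p
  join-Sound {i} {x} {xs} {b} {bs} {C} {p} px sx≡b S = record
    { edge = edge′
    ; path = λ y∈ → let (z , z∈ , e , _ , e′) = ∈-relink⁻ y∈ in
               subst₂ (Path s i) (sym e′) (sym e) (path′ z (Pick-⊆ px z∈))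
    ; type = λ y∈ → let (z , z∈ , e , e″ , _) = ∈-relink⁻ y∈ in
               trans e″ (trans (type (Pick-⊆ px z∈)) (cong (λ a → a <ᵇ t a) (sym e)))
    }
    where
    open Core C
    open View p
    open Sound S
    edge′ : ∀ {a c} → (out [ pos x ↦ b ]) a ≡ just c → s a ≡ c
    edge′ e with ↦-just out e
    ... | inj₁ (refl , refl) = sx≡b
    ... | inj₂ e′            = edge e′
    path′ : ∀ z → z ∈ op → Path s i (sub b (start x) (start z)) (pos z)
    path′ z z∈ with start z ≟ b
    ... | yes refl rewrite sub-≡ (start z) (start x) = Path-join (path (Pick-∈ px)) sx≡b (path z∈)
    ... | no ne rewrite sub-≢ {b} {start x} ne = path z∈

  -- Attaching the next vertex

  -- How vertex v is attached to [v + 1, n).  Every chosen slot or value comes with the ones left over.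
  data Choice : Set where
    fixed peak : Choice
    drise      : ℕ → List ℕ → Choice
    dfall      : Slot → List Slot → Choice
    valley     : Slot → List Slot → ℕ → List ℕ → Choice

  choices : Core → List Choice
  choices (core op ov _) = fixed ∷ peak ∷ map (λ (b , bs) → drise b bs) (picks ov)
    ++ map (λ (x , xs) → dfall x xs) (picks op)
    ++ concatMap (λ (x , xs) → map (λ (b , bs) → valley x xs b bs) (picks ov)) (picks op)

  data Fits (C : Core) : Choice → Set where
    fixed  : Fits C fixed
    peak   : Fits C peak
    drise  : ∀ {b bs} → Pick b (Core.ov C) bs → Fits C (drise b bs)
    dfall  : ∀ {x xs} → Pick x (Core.op C) xs → Fits C (dfall x xs)
    valley : ∀ {x xs b bs} → Pick x (Core.op C) xs → Pick b (Core.ov C) bs → Fits C (valley x xs b bs)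

  ∈-choices⁻ : ∀ {C c} → c ∈ choices C → Fits C c
  ∈-choices⁻ (here refl) = fixed
  ∈-choices⁻ (there (here refl)) = peak
  ∈-choices⁻ {C} (there (there c∈)) with ∈-++⁻ (map (λ (b , bs) → drise b bs) (picks (Core.ov C))) c∈
  ... | inj₁ c∈₁ with ∈-map⁻ _ c∈₁
  ...   | _ , p∈ , refl = drise (∈-picks⁻ _ p∈)
  ∈-choices⁻ {C} (there (there c∈)) | inj₂ c∈₂ with ∈-++⁻ (map (λ (x , xs) → dfall x xs) (picks (Core.op C))) c∈₂
  ...   | inj₁ c∈₃ with ∈-map⁻ _ c∈₃
  ...     | _ , p∈ , refl = dfall (∈-picks⁻ _ p∈)
  ∈-choices⁻ {C} (there (there c∈)) | inj₂ c∈₂ | inj₂ c∈₄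
    with find (∈-concatMap⁻ (λ (x , xs) → map (λ (b , bs) → valley x xs b bs) (picks (Core.ov C))) {xs = picks (Core.op C)} c∈₄)
  ...     | _ , q∈ , c∈₅ with ∈-map⁻ _ c∈₅
  ...       | _ , p∈ , refl = valley (∈-picks⁻ _ q∈) (∈-picks⁻ _ p∈)

  module _ (v : ℕ) where

    matches : Choice → View → Bool
    matches c p = go c
      where
      open View p
      go : Choice → Bool
      go fixed             = s v ≡ᵇ v
      go peak              = (s v <ᵇ v) ∧ (t v <ᵇ v)
      go (drise b _)       = (s v ≡ᵇ b) ∧ (t v <ᵇ v)
      go (dfall x _)       = (s v <ᵇ v) ∧ (s (pos x) ≡ᵇ v)
      go (valley x _ b _)  = (s v ≡ᵇ b) ∧ (s (pos x) ≡ᵇ v)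

    -- The vertex enters as an isolated path, open at both ends, and is then joined at neither end,
    -- at one or at both; a fixed point is joined to itself. In the valley case the position `v`
    -- already ends the path of `x`, and `sub v (start x) v` is the start that the first `join` has
    -- given to its slot.
    next : Core → Choice → Core
    next C fixed              = join (slot v false v) (Core.op C) v (Core.ov C) (add v false C)
    next C peak               = add v false C
    next C (drise b bs)       = join (slot v false v) (Core.op C) b (v ∷ bs) (add v false C)
    next C (dfall x xs)       = join x (slot v true v ∷ xs) v (Core.ov C) (add v true C)
    next C (valley x xs b bs) =
      join (slot v true (sub v (start x) v)) (map (relink v (start x)) xs) b bs (next C (dfall x xs))

    next-Wf : ∀ {n C c} → v < n → Fits C c → Wf n (suc v) C → Wf n v (next C c)
    next-Wf v<n fixed          W = join-Wf here here (add-Wf false v<n W)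
    next-Wf v<n peak           W = add-Wf false v<n W
    next-Wf v<n (drise pb)     W = join-Wf here (there pb) (add-Wf false v<n W)
    next-Wf v<n (dfall px)     W = join-Wf (there px) here (add-Wf true v<n W)
    next-Wf v<n (valley px pb) W = join-Wf here pb (next-Wf v<n (dfall px) W)

  -- Says that `C` is the whole restriction: known edges are edges of `p`, and an open end has its
  -- partner below `i`, so that no edge inside the interval is missing.
  record Compat (i : ℕ) (C : Core) (p : View) : Set where
    constructor compat
    open Core C
    open View p
    field
      edges : ∀ {a b} → out a ≡ just b → s a ≡ b
      op-<  : ∀ {x} → x ∈ op → s (pos x) < i
      ov-<  : ∀ {b} → b ∈ ov → t b < i

  -- P is the set of permutations whose restriction to [i, n) is C.
  record Valid (n i : ℕ) (C : Core) (P : View → Bool) : Set where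
    field
      wf       : Wf n i C
      sound    : ∀ {p} → Lawful n p → T (P p) → Sound i C p × Compat i C p
      complete : ∀ {p} → Lawful n p → Compat i C p → T (P p)

  join-edges⁻ : ∀ {n i x xs b C p} → Wf n i C → Pick x (Core.op C) xs →
    (∀ {a c} → (Core.out C [ pos x ↦ b ]) a ≡ just c → View.s p a ≡ c) →
    View.s p (pos x) ≡ b × (∀ {a c} → Core.out C a ≡ just c → View.s p a ≡ c)
  join-edges⁻ {x = x} {b = b} {C = C} W px h = h (↦-≡ out refl) , λ {a} {c} e → h (trans (↦-≢ out (a≢ e)) e)
    where
    open Core C
    a≢ : ∀ {a c} → out a ≡ just c → a ≢ pos x
    a≢ e refl with trans (sym e) (Wf.op-out W (Pick-∈ px))
    ... | ()

  module _ {n v : ℕ} {C : Core} {P : View → Bool} (v<n : v < n) (V : Valid n (suc v) C P) where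
    open Core C
    open Valid V
    open Wf wf

    module _ {p : View} (L : Lawful n p) where
      open View p
      open Lawful L

      module _ (K : Compat (suc v) C p) where
        open Compat K

        op-<∨ : ∀ {x} → x ∈ op → s (pos x) < v ⊎ t v ≡ pos x
        op-<∨ x∈ with m≤n⇒m<n∨m≡n (s≤s⁻¹ (op-< x∈))
        ... | inj₁ lt = inj₁ lt
        ... | inj₂ e  = inj₂ (t≡⇒ e)

        ov-<∨ : ∀ {b} → b ∈ ov → t b < v ⊎ s v ≡ b
        ov-<∨ b∈ with m≤n⇒m<n∨m≡n (s≤s⁻¹ (ov-< b∈))
        ... | inj₁ lt = inj₁ lt
        ... | inj₂ e  = inj₂ (s≡⇒ e)

        op-<ₜ : t v ≤ v → ∀ {x} → x ∈ op → s (pos x) < v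
        op-<ₜ tv≤v x∈ with op-<∨ x∈
        ... | inj₁ lt = lt
        ... | inj₂ e  = ⊥-elim (<⇒≱ (op-≥ x∈) (subst (_≤ v) e tv≤v))

        ov-<ₛ : s v ≤ v → ∀ {b} → b ∈ ov → t b < v
        ov-<ₛ sv≤v b∈ with ov-<∨ b∈
        ... | inj₁ lt = lt
        ... | inj₂ e  = ⊥-elim (<⇒≱ (ov-≥ b∈) (subst (_≤ v) e sv≤v))

        op-<ₚ : ∀ {x xs} → Pick x op xs → s (pos x) ≡ v → ∀ {y} → y ∈ xs → s (pos y) < v
        op-<ₚ px e y∈ with op-<∨ (Pick-⊆ px y∈)
        ... | inj₁ lt = lt
        ... | inj₂ e′ = ⊥-elim (Pick-apart op-sorted px y∈ (trans (sym e′) (t≡⇒ e)))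

        ov-<ₚ : ∀ {b bs} → Pick b ov bs → s v ≡ b → ∀ {c} → c ∈ bs → t c < v
        ov-<ₚ pb e c∈ with ov-<∨ (Pick-⊆ pb c∈)
        ... | inj₁ lt = lt
        ... | inj₂ e′ = ⊥-elim (Pick-apart ov-sorted pb c∈ (trans (sym e′) e))

        relink-< : ∀ {b c xs} → (∀ {y} → y ∈ xs → s (pos y) < v) → ∀ {x} → x ∈ map (relink b c) xs → s (pos x) < v
        relink-< h x∈ = let (y , y∈ , e , _) = ∈-relink⁻ x∈ in subst (λ a → s a < v) (sym e) (h y∈)

        -- Every open end of `C` has its partner at most `v`. The ends with partner `v` itself are
        -- those that the choice joins to `v`; as positions and values are distinct, all others have
        -- their partner below `v`.
        next-sound : ∀ {c} → Fits C c → T (matches v c p) → Sound (suc v) C p →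
                     Sound v (next v C c) p × (∀ {x} → x ∈ Core.op (next v C c) → s (pos x) < v) ×
                     (∀ {b} → b ∈ Core.ov (next v C c) → t b < v)
        next-sound fixed m S =
          join-Sound here sv (add-Sound (sym (¬T⇒≡false λ lt → <-irrefl (sym (t≡⇒ sv)) (<ᵇ⇒< _ _ lt))) S) ,
          relink-< (op-<ₜ (≤-reflexive (t≡⇒ sv))) ,
          ov-<ₛ (≤-reflexive sv)
          where
          sv = ≡ᵇ⇒≡ (s v) v m
        next-sound peak m S =
          add-Sound (sym (¬T⇒≡false λ lt → <-asym tv (<ᵇ⇒< _ _ lt))) S ,
          (λ { (here refl) → sv ; (there x∈) → op-<ₜ (<⇒≤ tv) x∈ }) ,
          (λ { (here refl) → tv ; (there x∈) → ov-<ₛ (<⇒≤ sv) x∈ })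
          where
          sv = <ᵇ⇒< (s v) v (proj₁ (T-∧⁻ m))
          tv = <ᵇ⇒< (t v) v (proj₂ (T-∧⁻ m))
        next-sound (drise {b} pb) m S =
          join-Sound here sv (add-Sound (sym (¬T⇒≡false λ lt → <-asym tv (<ᵇ⇒< _ _ lt))) S) ,
          relink-< (op-<ₜ (<⇒≤ tv)) ,
          (λ { (here refl) → tv ; (there x∈) → ov-<ₚ pb sv x∈ })
          where
          sv = ≡ᵇ⇒≡ (s v) b (proj₁ (T-∧⁻ m))
          tv = <ᵇ⇒< (t v) v (proj₂ (T-∧⁻ m))
        next-sound (dfall {x} px) m S =
          join-Sound (there px) sx (add-Sound (sym (T⇒≡true (<⇒<ᵇ (subst (v <_) (sym (t≡⇒ sx)) (op-≥ (Pick-∈ px)))))) S) ,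
          relink-< {xs = slot v true v ∷ _} (λ { (here refl) → sv ; (there y∈) → op-<ₚ px sx y∈ }) ,
          ov-<ₛ (<⇒≤ sv)
          where
          sv = <ᵇ⇒< (s v) v (proj₁ (T-∧⁻ m))
          sx = ≡ᵇ⇒≡ (s (pos x)) v (proj₂ (T-∧⁻ {s v <ᵇ v} m))
        next-sound (valley {x} {b = b} px pb) m S =
          join-Sound here sv (join-Sound {bs = ov} (there px) sx
            (add-Sound (sym (T⇒≡true (<⇒<ᵇ (subst (v <_) (sym (t≡⇒ sx)) (op-≥ (Pick-∈ px)))))) S)) ,
          relink-< (relink-< (op-<ₚ px sx)) ,
          ov-<ₚ pb sv
          where
          sv = ≡ᵇ⇒≡ (s v) b (proj₁ (T-∧⁻ m))
          sx = ≡ᵇ⇒≡ (s (pos x)) v (proj₂ (T-∧⁻ {s v ≡ᵇ b} m))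

      <-suc : ∀ {a} → a < v → a < suc v
      <-suc = m<n⇒m<1+n

      next-complete : ∀ {c} → Fits C c → Compat v (next v C c) p → Compat (suc v) C p × T (matches v c p)
      next-complete fixed (compat ed o< v<) with join-edges⁻ {p = p} (add-Wf false v<n wf) here ed
      ... | sv , ed′ = compat ed′ (λ x∈ → <-suc (o< (∈-map⁺ (relink v v) x∈))) (λ b∈ → <-suc (v< b∈)) , ≡⇒≡ᵇ _ _ sv
      next-complete peak (compat ed o< v<) =
        compat ed (λ x∈ → <-suc (o< (there x∈))) (λ b∈ → <-suc (v< (there b∈))) ,
        T-∧⁺ (<⇒<ᵇ (o< (here refl))) (<⇒<ᵇ (v< (here refl)))
      next-complete (drise {b} pb) (compat ed o< v<) with join-edges⁻ {p = p} (add-Wf false v<n wf) here ed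
      ... | sv , ed′ =
        compat ed′ (λ x∈ → <-suc (o< (∈-map⁺ (relink b v) x∈)))
          (λ c∈ → case-ov (Pick-split pb c∈)) ,
        T-∧⁺ (≡⇒≡ᵇ _ _ sv) (<⇒<ᵇ (v< (here refl)))
        where
        case-ov : ∀ {c} → c ≡ b ⊎ c ∈ _ → t c < suc v
        case-ov (inj₁ refl) = s≤s (≤-reflexive (t≡⇒ sv))
        case-ov (inj₂ c∈)   = <-suc (v< (there c∈))
      next-complete (dfall {x} {xs} px) (compat ed o< v<) with join-edges⁻ {p = p} (add-Wf true v<n wf) (there px) ed
      ... | sx , ed′ =
        compat ed′ (λ y∈ → case-op (Pick-split px y∈)) (λ b∈ → <-suc (v< b∈)) ,
        T-∧⁺ (<⇒<ᵇ (o< (here refl))) (≡⇒≡ᵇ _ _ sx)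
        where
        case-op : ∀ {y} → y ≡ x ⊎ y ∈ xs → s (pos y) < suc v
        case-op (inj₁ refl) = s≤s (≤-reflexive sx)
        case-op (inj₂ y∈)   = <-suc (o< (there (∈-map⁺ (relink v (start x)) y∈)))
      next-complete (valley {x} {xs} {b} {bs} px pb) (compat ed o< v<)
        with join-edges⁻ {p = p} (next-Wf v v<n (dfall px) wf) here ed
      ... | sv , ed₁ with join-edges⁻ {p = p} (add-Wf true v<n wf) (there px) ed₁
      ...   | sx , ed₂ =
        compat ed₂ (λ y∈ → case-op (Pick-split px y∈)) (λ c∈ → case-ov (Pick-split pb c∈)) ,
        T-∧⁺ (≡⇒≡ᵇ _ _ sv) (≡⇒≡ᵇ _ _ sx)
        where
        case-op : ∀ {y} → y ≡ x ⊎ y ∈ xs → s (pos y) < suc v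
        case-op (inj₁ refl) = s≤s (≤-reflexive sx)
        case-op (inj₂ y∈)   = <-suc (o< (∈-map⁺ (relink b _) (∈-map⁺ (relink v (start x)) y∈)))
        case-ov : ∀ {c} → c ≡ b ⊎ c ∈ bs → t c < suc v
        case-ov (inj₁ refl) = s≤s (≤-reflexive (t≡⇒ sv))
        case-ov (inj₂ c∈)   = <-suc (v< c∈)

    next-Valid : ∀ {c} → Fits C c → Valid n v (next v C c) (λ p → P p ∧ matches v c p)
    next-Valid {c} fc = record
      { wf       = next-Wf v v<n fc wf
      ; sound    = λ {p} L h →
          let (hP , hm) = T-∧⁻ {P p} h
              (S , K)   = sound L hP
              (S′ , o< , v<) = next-sound L K fc hm S
          in S′ , compat (Sound.edge S′) o< v<
      ; complete = λ {p} L K → let (K′ , m) = next-complete L fc K in T-∧⁺ (complete L K′) m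
      }

    -- Statistics read off the open positions and values

    module _ {p : View} (L : Lawful n p) (hP : T (P p)) where
      open View p
      open Lawful L
      private
        S = proj₁ (sound L hP)
        K = proj₂ (sound L hP)
      open Sound S
      open Compat K

      -- From `n` on every index is fixed, so `a` lies below `n`; and if its edge were already
      -- known, its image would exceed `v`.
      op-intro : ∀ {a} → v < a → s a ≤ v → ∃ λ x → x ∈ op × pos x ≡ a
      op-intro {a} v<a sa≤v with out-dom v<a (≰⇒> λ n≤a → <⇒≱ v<a (subst (_≤ v) (outside a n≤a) sa≤v))
      ... | inj₁ r       = r
      ... | inj₂ (b , e) = ⊥-elim (<⇒≱ (proj₂ (out-≥ e)) (subst (_≤ v) (edge e) sa≤v))

      ov-intro : ∀ {b} → v < b → t b ≤ v → b ∈ ov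
      ov-intro {b} v<b tb≤v with out-cod v<b (≰⇒> λ n≤b → <⇒≱ v<b (subst (_≤ v) (t≡⇒ (outside b n≤b)) tb≤v))
      ... | inj₁ r       = r
      ... | inj₂ (a , e) = ⊥-elim (<⇒≱ (proj₁ (out-≥ e)) (subst (_≤ v) (t≡⇒ (edge e)) tb≤v))

      -- The values above `v` with preimage below `v` are exactly the open values, which are as many
      -- as the slots.
      nest-fixed : s v ≡ v → nest v ≡ length op
      nest-fixed sv = trans
        (nest-length v<n ov (sorted⇒Unique ov-sorted) (λ b b∈ → ov-≥ b∈ , ov-<ₛ L K (≤-reflexive sv) b∈)
          (λ b v<b tb<v → ov-intro v<b (<⇒≤ tb<v)))
        (trans (sym (↭-length starts)) (length-map start op))

      -- An earlier position with a larger image has this image above `v`, hence among the open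
      -- values; conversely, every other open value has its preimage before `v`.
      rec-drise : ∀ {b bs} → Pick b ov bs → s v ≡ b → all (_<ᵇ b) bs ≡ rec v
      rec-drise {b} {bs} pb sv = T-injective
        (λ h → rec⁺ v<n (λ j j<v → ≰⇒> (λ sv≤sj → below h j j<v sv≤sj)))
        (λ r → all⁺ _ bs (λ c c∈ → <⇒<ᵇ (subst₂ _<_ (s∘t c) sv (rec⁻ v<n r (t c) (ov-<ₚ L K pb sv c∈)))))
        where
        below : T (all (_<ᵇ b) bs) → ∀ j → j < v → s v ≤ s j → ⊥
        below h j j<v sv≤sj with Pick-split pb (ov-intro (<-≤-trans (subst (v <_) (sym sv) (ov-≥ (Pick-∈ pb))) sv≤sj)
                                         (subst (_≤ v) (sym (t∘s j)) (<⇒≤ j<v)))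
        ... | inj₁ e  = <-irrefl (s-injective (trans e (sym sv))) j<v
        ... | inj₂ c∈ = <⇒≱ (<ᵇ⇒< _ _ (all⁻ _ h c∈)) (subst (_≤ s j) sv sv≤sj)

      -- The slots other than `x` have images below `v`, the image of `pos x`. Those to the right of
      -- `pos x` thus violate the antirecord condition, and by `op-intro` nothing else can.
      anti-fall : ∀ {x xs} → Pick x op xs → s (pos x) ≡ v → all (λ y → pos y <ᵇ pos x) xs ≡ anti (pos x)
      anti-fall {x} {xs} px sx = T-injective
        (λ h → anti⁺ x<n (λ j x<j → ≰⇒> (λ sj≤ → above h j x<j sj≤)))
        (λ r → all⁺ _ xs (λ y y∈ → <⇒<ᵇ (≤∧≢⇒< (≮⇒≥ (λ x<y →
           <⇒≱ (anti⁻ x<n r (pos y) x<y) (subst (s (pos y) ≤_) (sym sx) (s≤s⁻¹ (op-< (Pick-⊆ px y∈))))))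
           (Pick-apart op-sorted px y∈))))
        where
        x<n = op-<n (Pick-∈ px)
        above : T (all (λ y → pos y <ᵇ pos x) xs) → ∀ j → pos x < j → s j ≤ s (pos x) → ⊥
        above h j x<j sj≤ with op-intro (<-trans (op-≥ (Pick-∈ px)) x<j) (subst (s j ≤_) sx sj≤)
        ... | y , y∈ , refl with Pick-split px y∈
        ...   | inj₁ refl = <-irrefl refl x<j
        ...   | inj₂ y∈′  = <-asym x<j (<ᵇ⇒< _ _ (all⁻ _ h y∈′))

      -- The valley v closes a cycle, of which it is the minimum, exactly when it joins a path to its own start.
      cmin-valley : ∀ {x xs b bs} → Pick x op xs → Pick b ov bs → s (pos x) ≡ v → s v ≡ b → (b ≡ᵇ start x) ≡ cmin v
      cmin-valley {x} {xs} {b} {bs} px pb sx sv = T-injective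
        (λ h → cmin⁺ v<n (closed-≥ (subst (λ a → Path s (suc v) a (pos x)) (trans (sym (≡ᵇ⇒≡ b _ h)) (sym sv)) (path (Pick-∈ px))) sx))
        (λ r → ≡⇒≡ᵇ b (start x) (closes (cmin⁻ v<n r)))
        where
        closes : (∀ k → v ≤ iterate s k v) → b ≡ start x
        closes h with ∈-map⁻ start (∈-resp-↭ (↭-sym starts) (Pick-∈ pb))
        ... | y , y∈ , refl with Pick-split px y∈
        ...   | inj₁ refl = refl
        -- If the path starting at `b` ended at another slot, the orbit of `v` would leave the
        -- interval: one step to `b`, `k` along the path, and one more to a vertex below `v`.
        ...   | inj₂ y∈′ with Path-iterate (path y∈)
        ...     | k , e = ⊥-elim (<⇒≱ (op-<ₚ L K px sx y∈′) (subst (v ≤_)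
                    (cong s (trans (iterate-suc s k v) (trans (cong (iterate s k) sv) e))) (h (suc (suc k)))))

  -- The view of a permutation vector

  sameElements⇒↭ : ∀ {A : Set} {xs ys : List A} → Unique xs → Unique ys →
                   (∀ {x} → x ∈ xs → x ∈ ys) → (∀ {x} → x ∈ ys → x ∈ xs) → xs ↭ ys
  sameElements⇒↭ u u′ f g = ∼bag⇒↭ (unique∧set⇒bag u u′ (mk⇔ f g))

  module _ {A : Set} {n : ℕ} (d : ℕ → A) (f : Fin n → A) where

    extend : ℕ → A
    extend j with j <? n
    ... | yes j<n = f (fromℕ< j<n)
    ... | no  _   = d j

    extend-toℕ : ∀ i → extend (toℕ i) ≡ f i
    extend-toℕ i with toℕ i <? n
    ... | yes i<n = cong f (fromℕ<-toℕ i i<n)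
    ... | no  i≮n = ⊥-elim (i≮n (toℕ<n i))

    extend-≥ : ∀ {j} → n ≤ j → extend j ≡ d j
    extend-≥ {j} n≤j with j <? n
    ... | yes j<n = ⊥-elim (<⇒≱ j<n n≤j)
    ... | no  _   = refl

  -- `g` is injective because `f` undoes it. If it missed `j`, deleting `j` from its codomain would
  -- inject a set of `suc n` elements into one of `n`.
  rightInverse⇒leftInverse : ∀ {n} (f g : Fin n → Fin n) → (∀ i → f (g i) ≡ i) → ∀ j → g (f j) ≡ j
  rightInverse⇒leftInverse {suc n} f g fg j with any? (λ i → g i ≟ᶠ j)
  ... | yes (i , e) = trans (cong (g ∘ f) (sym e)) (trans (cong g (fg i)) e)
  ... | no  ne      = ⊥-elim (<-irrefl refl (injective⇒≤ {f = λ i → punchOut (λ e → ne (i , sym e))}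
      (λ {i} {k} e → trans (sym (fg i)) (trans (cong f (punchOut-injective (λ e → ne (i , sym e)) (λ e → ne (k , sym e)) e)) (fg k)))))

  module _ {n : ℕ} (σ : Vec (Fin n) n) where
    open Stats σ

    view : View
    view = record
      { s    = extend id ap
      ; t    = extend id inv
      ; rec  = extend (const false) isRecord
      ; anti = extend (const false) isAntirecord
      ; cmin = extend (const false) isCycleMin
      ; nest = extend (const 0) psnest
      }

    open View view

    -- The fold in `inv` falls back to `toℕ i` when it meets no preimage; the hypothesis rules this
    -- out.
    inv-∈ : ∀ (i : Fin n) (js : List (Fin n)) → (∃ λ j → j ∈ js × ap j ≡ toℕ i) →
            ∃ λ j → foldr (λ j r → if ap j ≡ᵇ toℕ i then toℕ j else r) (toℕ i) js ≡ toℕ j × ap j ≡ toℕ i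
    inv-∈ i (j ∷ js) h with ap j ≡ᵇ toℕ i in eq | h
    ... | true  | _                       = j , refl , ≡ᵇ⇒≡ _ _ (subst T (sym eq) _)
    ... | false | _ , here refl , e       = ⊥-elim (subst T eq (≡⇒≡ᵇ _ _ e))
    ... | false | k , there k∈ , e        = inv-∈ i js (k , k∈ , e)

    module _ (perm : T (isPerm σ)) where

      private
        surjective : ∀ i → ∃ λ j → inv i ≡ toℕ j × ap j ≡ toℕ i
        surjective i with find (any⁻ (λ j → ap j ≡ᵇ toℕ i) (allFin n) (all⁻ (λ i → any (λ j → ap j ≡ᵇ toℕ i) (allFin n)) perm (∈-allFin i)))
        ... | j , j∈ , e = inv-∈ i (allFin n) (j , j∈ , ≡ᵇ⇒≡ _ _ e)

      σ⁻¹ : Fin n → Fin n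
      σ⁻¹ i = proj₁ (surjective i)

      inv≡ : ∀ i → inv i ≡ toℕ (σ⁻¹ i)
      inv≡ i = proj₁ (proj₂ (surjective i))

      σ∘σ⁻¹ : ∀ i → lookup σ (σ⁻¹ i) ≡ i
      σ∘σ⁻¹ i = toℕ-injective (proj₂ (proj₂ (surjective i)))

      σ⁻¹∘σ : ∀ j → σ⁻¹ (lookup σ j) ≡ j
      σ⁻¹∘σ = rightInverse⇒leftInverse (lookup σ) σ⁻¹ σ∘σ⁻¹

      s-toℕ : ∀ i → s (toℕ i) ≡ toℕ (lookup σ i)
      s-toℕ = extend-toℕ id ap

      t-toℕ : ∀ i → t (toℕ i) ≡ toℕ (σ⁻¹ i)
      t-toℕ i = trans (extend-toℕ id inv i) (inv≡ i)

      iterate-toℕ : ∀ k i → iterate s k (toℕ i) ≡ toℕ (iter k i)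
      iterate-toℕ zero    i = refl
      iterate-toℕ (suc k) i = trans (cong s (iterate-toℕ k i)) (s-toℕ (iter k i))

      iter-+ : ∀ a b i → iter (a + b) i ≡ iter a (iter b i)
      iter-+ zero    b i = refl
      iter-+ (suc a) b i = cong (lookup σ) (iter-+ a b i)

      -- isCycleMin inspects only the first n iterates.
      iter-bounded : ∀ (Q : Fin n → Set) i → (∀ k → k < n → Q (iter k i)) → ∀ k → Q (iter k i)
      iter-bounded Q i h = <-rec _ shorten
        where
        shorten : ∀ k → (∀ {m} → m < k → Q (iter m i)) → Q (iter k i)
        shorten k ih with k <? n
        ... | yes k<n = h k k<n
        -- Two of the iterates with index at most `n` agree; cutting out the loop between them gives
        -- the same vertex at a smaller index.
        ... | no  k≮n with pigeonhole (n<1+n n) (λ (a : Fin (suc n)) → iter (toℕ a) i)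
        ...   | a , b , a<b , e = subst Q same (ih shorter)
          where
          b≤k : toℕ b ≤ k
          b≤k = ≤-trans (s≤s⁻¹ (toℕ<n b)) (≮⇒≥ k≮n)
          same : iter (k ∸ toℕ b + toℕ a) i ≡ iter k i
          same = trans (iter-+ (k ∸ toℕ b) (toℕ a) i) (trans (cong (iter (k ∸ toℕ b)) e)
            (trans (sym (iter-+ (k ∸ toℕ b) (toℕ b) i)) (cong (λ m → iter m i) (m∸n+n≡m b≤k))))
          shorter : k ∸ toℕ b + toℕ a < k
          shorter = <-≤-trans (+-monoʳ-< (k ∸ toℕ b) a<b) (≤-reflexive (m∸n+n≡m b≤k))

      private
        onFin : ∀ (Q : ℕ → Set) → (∀ (i : Fin n) → Q (toℕ i)) → (∀ j → n ≤ j → Q j) → ∀ j → Q j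
        onFin Q f g j with j <? n
        ... | yes j<n = subst Q (toℕ-fromℕ< j<n) (f (fromℕ< j<n))
        ... | no  j≮n = g j (≮⇒≥ j≮n)

        below : ∀ (Q : ℕ → Set) → (∀ (i : Fin n) → Q (toℕ i)) → ∀ {j} → j < n → Q j
        below Q f j<n = subst Q (toℕ-fromℕ< j<n) (f (fromℕ< j<n))

        ap< : ∀ i → s (toℕ i) < n
        ap< i = subst (_< n) (sym (s-toℕ i)) (toℕ<n (lookup σ i))

      view-lawful : Lawful n view
      view-lawful = record
        { s∘t = onFin _ (λ i → trans (cong s (t-toℕ i)) (trans (s-toℕ (σ⁻¹ i)) (cong toℕ (σ∘σ⁻¹ i))))
                        (λ j n≤j → trans (cong s (extend-≥ id inv n≤j)) (extend-≥ id ap n≤j))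
        ; t∘s = onFin _ (λ i → trans (cong t (s-toℕ i)) (trans (t-toℕ (lookup σ i)) (cong toℕ (σ⁻¹∘σ i))))
                        (λ j n≤j → trans (cong t (extend-≥ id ap n≤j)) (extend-≥ id inv n≤j))
        ; outside = λ j → extend-≥ id ap
        ; rec⁺ = below (λ v → (∀ j → j < v → s j < s v) → T (rec v)) λ i h →
            subst T (sym (extend-toℕ _ isRecord i)) (all⁺ _ (allFin n) λ j _ → T-⇒⁺ λ j<i →
              <⇒<ᵇ (subst₂ _<_ (s-toℕ j) (s-toℕ i) (h (toℕ j) (<ᵇ⇒< _ _ j<i))))
        ; rec⁻ = below (λ v → T (rec v) → ∀ j → j < v → s j < s v) λ i h → onFin _
            (λ j j<i → subst₂ _<_ (sym (s-toℕ j)) (sym (s-toℕ i)) (<ᵇ⇒< _ _ (T-⇒⁻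
               (all⁻ (λ j → not (toℕ j <ᵇ toℕ i) ∨ (ap j <ᵇ ap i)) (subst T (extend-toℕ _ isRecord i) h) (∈-allFin j)) (<⇒<ᵇ j<i))))
            (λ j n≤j j<i → ⊥-elim (<⇒≱ (<-trans j<i (toℕ<n i)) n≤j))
        ; anti⁺ = below (λ v → (∀ j → v < j → s v < s j) → T (anti v)) λ i h →
            subst T (sym (extend-toℕ _ isAntirecord i)) (all⁺ _ (allFin n) λ j _ → T-⇒⁺ λ i<j →
              <⇒<ᵇ (subst₂ _<_ (s-toℕ i) (s-toℕ j) (h (toℕ j) (<ᵇ⇒< _ _ i<j))))
        ; anti⁻ = below (λ v → T (anti v) → ∀ j → v < j → s v < s j) λ i h → onFin _
            (λ j i<j → subst₂ _<_ (sym (s-toℕ i)) (sym (s-toℕ j)) (<ᵇ⇒< _ _ (T-⇒⁻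
               (all⁻ (λ j → not (toℕ i <ᵇ toℕ j) ∨ (ap i <ᵇ ap j)) (subst T (extend-toℕ _ isAntirecord i) h) (∈-allFin j)) (<⇒<ᵇ i<j))))
            (λ j n≤j _ → subst (s (toℕ i) <_) (sym (extend-≥ id ap n≤j)) (<-≤-trans (ap< i) n≤j))
        ; cmin⁺ = below (λ v → (∀ k → v ≤ iterate s k v) → T (cmin v)) λ i h →
            subst T (sym (extend-toℕ _ isCycleMin i)) (all⁺ _ (upTo n) λ k _ →
              ≤⇒≤ᵇ (subst (toℕ i ≤_) (iterate-toℕ k i) (h k)))
        ; cmin⁻ = below (λ v → T (cmin v) → ∀ k → v ≤ iterate s k v) λ i h k →
            subst (toℕ i ≤_) (sym (iterate-toℕ k i)) (iter-bounded (λ j → toℕ i ≤ toℕ j) i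
              (λ m m<n → ≤ᵇ⇒≤ _ _ (all⁻ (λ k → toℕ i ≤ᵇ toℕ (iter k i)) (subst T (extend-toℕ _ isCycleMin i) h) (∈-upTo⁺ m<n))) k)
        ; nest-length = below (λ v → ∀ bs → Unique bs → (∀ b → b ∈ bs → v < b × t b < v) →
                           (∀ b → v < b → t b < v → b ∈ bs) → nest v ≡ length bs) λ i bs u f g →
            -- `psnest` counts positions while `bs` lists values; the injection `ap` carries the
            -- former to the latter.
            trans (extend-toℕ _ psnest i) (trans (sym (length-map ap (nesting i)))
              (↭-length (sameElements⇒↭ (Unique-map⁺ ap-injective (Unique-filter⁺ (T? ∘ nests i) (allFin⁺ n))) u
                (λ x∈ → to i g (∈-map⁻ ap x∈)) (λ {b} b∈ → from i b (f b b∈)))))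
        }
        where
        nests : Fin n → Fin n → Bool
        nests i j = (toℕ j <ᵇ toℕ i) ∧ (toℕ i <ᵇ ap j)
        nesting : Fin n → List (Fin n)
        nesting i = filterᵇ (nests i) (allFin n)
        ap-injective : ∀ {j k} → ap j ≡ ap k → j ≡ k
        ap-injective {j} {k} e = trans (sym (σ⁻¹∘σ j)) (trans (cong σ⁻¹ (toℕ-injective e)) (σ⁻¹∘σ k))
        to : ∀ i {bs b} → (∀ b → toℕ i < b → t b < toℕ i → b ∈ bs) → (∃ λ j → j ∈ nesting i × b ≡ ap j) → b ∈ bs
        to i g (j , j∈ , refl) with T-∧⁻ {toℕ j <ᵇ toℕ i} (proj₂ (∈-filter⁻ (T? ∘ nests i) {xs = allFin n} j∈))
        ... | j<i , i<apj = g (ap j) (<ᵇ⇒< _ _ i<apj)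
          (subst (_< toℕ i) (sym (trans (t-toℕ (lookup σ j)) (cong toℕ (σ⁻¹∘σ j)))) (<ᵇ⇒< _ _ j<i))
        from : ∀ i b → toℕ i < b × t b < toℕ i → b ∈ map ap (nesting i)
        from i = onFin _
          (λ b (i<b , tb<i) → subst (_∈ map ap (nesting i)) (cong toℕ (σ∘σ⁻¹ b))
            (∈-map⁺ ap (∈-filter⁺ (T? ∘ nests i) (∈-allFin (σ⁻¹ b))
              (T-∧⁺ (<⇒<ᵇ (subst (_< toℕ i) (t-toℕ b) tb<i)) (<⇒<ᵇ (subst (toℕ i <_) (cong toℕ (sym (σ∘σ⁻¹ b))) i<b))))))
          (λ b n≤b (i<b , tb<i) → ⊥-elim (<-asym i<b (subst (_< toℕ i) (extend-≥ id inv n≤b) tb<i)))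

  -- Falls are not records, rises are not antirecords

  injective-≤ : ∀ {f : ℕ → ℕ} {m i} → Injective _≡_ _≡_ f → (∀ j → j ≤ m → f j ≤ i) → m ≤ i
  injective-≤ {f} {m} {i} inj h = s≤s⁻¹ (injective⇒≤ {f = λ (j : Fin (suc m)) → fromℕ< (bound j)}
    (λ {j} {k} e → toℕ-injective (inj (trans (sym (toℕ-fromℕ< (bound j))) (trans (cong toℕ e) (toℕ-fromℕ< (bound k)))))))
    where
    bound : ∀ (j : Fin (suc m)) → f (toℕ j) < suc i
    bound j = s≤s (h (toℕ j) (s≤s⁻¹ (toℕ<n j)))

  module _ {n p} (L : Lawful n p) where
    open View p
    open Lawful L

    -- For a record `v`, `s` maps the initial segment up to `v` injectively into the one up to
    -- `s v`, which forces `v ≤ s v`. Hence for peaks and double falls an exclusive antirecord is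
    -- just an antirecord.
    fall⇒¬rec : ∀ {v} → v < n → s v < v → rec v ≡ false
    fall⇒¬rec {v} v<n sv<v = ¬T⇒≡false λ r → <⇒≱ sv<v (injective-≤ s-injective λ j j≤v → ≤-of r j (m≤n⇒m<n∨m≡n j≤v))
      where
      ≤-of : T (rec v) → ∀ j → j < v ⊎ j ≡ v → s j ≤ s v
      ≤-of r j (inj₁ j<v)  = <⇒≤ (rec⁻ v<n r j j<v)
      ≤-of r j (inj₂ refl) = ≤-refl

    -- The dual argument: for an antirecord `v`, the inverse `t` maps the initial segment up to
    -- `s v` into the one up to `v`.
    rise⇒¬anti : ∀ {v} → v < n → v < s v → anti v ≡ false
    rise⇒¬anti {v} v<n v<sv = ¬T⇒≡false λ r → <⇒≱ v<sv (injective-≤ t-injective λ c c≤sv →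
        ≮⇒≥ λ v<tc → <⇒≱ (anti⁻ v<n r (t c) v<tc) (subst (_≤ s v) (sym (s∘t c)) c≤sv))
      where
      t-injective : ∀ {a b} → t a ≡ t b → a ≡ b
      t-injective {a} {b} e = trans (sym (s∘t a)) (trans (cong s e) (s∘t b))

  -- The one completion of a restriction with nothing open

  views : ℕ → List View
  views n = map view (perms n)

  module _ {n : ℕ} where

    perms-isPerm : ∀ {σ} → σ ∈ perms n → T (isPerm σ)
    perms-isPerm = proj₂ ∘ ∈-filter⁻ (T? ∘ isPerm) {xs = allVecs n n}

    views-lawful : ∀ {p} → p ∈ views n → Lawful n p
    views-lawful p∈ with ∈-map⁻ view p∈
    ... | σ , σ∈ , refl = view-lawful σ (perms-isPerm σ∈)

    module _ {C P} (V : Valid n 0 C P) (op≡[] : Core.op C ≡ []) where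
      open Core C
      open Valid V
      open Wf wf

      private
        op-empty : ∀ {A : Set} {x} → x ∈ op → A
        op-empty x∈ with subst (_ ∈_) op≡[] x∈
        ... | ()

        ov-empty : ∀ {A : Set} {b} → b ∈ ov → A
        ov-empty b∈ with subst (_ ∈_) (↭-empty-inv (↭-sym (subst (λ xs → map start xs ↭ ov) op≡[] starts))) b∈
        ... | ()

        image : ∀ i → ∃ λ b → out (toℕ i) ≡ just b
        image i with out-dom z≤n (toℕ<n i)
        ... | inj₁ (_ , x∈ , _) = op-empty x∈
        ... | inj₂ r            = r

      completion : Vec (Fin n) n
      completion = tabulate (λ i → fromℕ< (proj₂ (out-<n (proj₂ (image i)))))

      completion-out : ∀ i → out (toℕ i) ≡ just (toℕ (lookup completion i))
      completion-out i = trans (proj₂ (image i)) (cong just (sym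
        (trans (cong toℕ (lookup∘tabulate _ i)) (toℕ-fromℕ< (proj₂ (out-<n (proj₂ (image i))))))))

      completion-isPerm : T (isPerm completion)
      completion-isPerm = all⁺ _ (allFin n) λ i _ → any⁺ _ (hit i)
        where
        open Stats completion
        hit : ∀ i → _
        hit i with out-cod z≤n (toℕ<n i)
        ... | inj₁ b∈      = ov-empty b∈
        ... | inj₂ (a , e) = lose (∈-allFin j) (≡⇒≡ᵇ (ap j) (toℕ i) (just-injective
                (trans (sym (completion-out j)) (trans (cong out (toℕ-fromℕ< a<n)) e))))
          where
          a<n = proj₁ (out-<n e)
          j = fromℕ< a<n

      completion-P : T (P (view completion))
      completion-P = complete (view-lawful completion completion-isPerm) (compat edges op-empty ov-empty)
        where
        edges : ∀ {a b} → out a ≡ just b → View.s (view completion) a ≡ b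
        edges {a} {b} e = trans (cong (View.s (view completion)) (sym a≡))
          (trans (s-toℕ completion completion-isPerm j) (just-injective
            (trans (sym (completion-out j)) (trans (cong out a≡) e))))
          where
          j = fromℕ< (proj₁ (out-<n e))
          a≡ : toℕ j ≡ a
          a≡ = toℕ-fromℕ< (proj₁ (out-<n e))

      completion-unique : ∀ σ → T (isPerm σ) → T (P (view σ)) → σ ≡ completion
      completion-unique σ perm hP = trans (sym (tabulate∘lookup σ)) (trans
        (tabulate-cong λ i → toℕ-injective (trans (sym (s-toℕ σ perm i))
          (Sound.edge (proj₁ (sound (view-lawful σ perm) hP)) (completion-out i))))
        (tabulate∘lookup completion))

open Combinatorics
open import Data.Nat.Properties as ℕₚ using (≡⇒≡ᵇ; ≡ᵇ⇒≡; <⇒<ᵇ; <ᵇ⇒<; <⇒≱; <⇒≢; <⇒≤; ≤-refl; ≤-reflexive; <-asym; <-cmp; n≮0; suc-injective)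
open import Relation.Binary.PropositionalEquality as ≡ using (_≡_; _≢_)

-- Finite sums and products in a commutative ring

module BigSums {c ℓ} (R : CommutativeRing c ℓ) where
  open CommutativeRing R
  open RingDefs R
  open import Relation.Binary.Reasoning.Setoid setoid
  open import Algebra.Solver.Ring.NaturalCoefficients.Default commutativeSemiring

  private variable
    A B : Set

  ∑ ∏ : List A → (A → Carrier) → Carrier
  ∑ xs f = sumL (map f xs)
  ∏ xs f = prodL (map f xs)

  ∑-cong : ∀ (xs : List A) {f g} → (∀ x → x ∈ xs → f x ≈ g x) → ∑ xs f ≈ ∑ xs g
  ∑-cong []       eq = refl
  ∑-cong (x ∷ xs) eq = +-cong (eq x (here ≡.refl)) (∑-cong xs (λ y y∈ → eq y (there y∈)))

  ∏-cong : ∀ (xs : List A) {f g} → (∀ x → f x ≈ g x) → ∏ xs f ≈ ∏ xs g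
  ∏-cong []       eq = refl
  ∏-cong (x ∷ xs) eq = *-cong (eq x) (∏-cong xs eq)

  ∑-zero : ∀ (xs : List A) {f} → (∀ x → x ∈ xs → f x ≈ 0#) → ∑ xs f ≈ 0#
  ∑-zero []       eq = refl
  ∑-zero (x ∷ xs) eq =
    trans (+-cong (eq x (here ≡.refl)) (∑-zero xs (λ y y∈ → eq y (there y∈)))) (+-identityˡ 0#)

  ∑-+ : ∀ (xs : List A) f g → ∑ xs (λ x → f x + g x) ≈ ∑ xs f + ∑ xs g
  ∑-+ []       f g = sym (+-identityˡ 0#)
  ∑-+ (x ∷ xs) f g = trans (+-congˡ (∑-+ xs f g))
    (solve 4 (λ a b c d → (a :+ b) :+ (c :+ d) := (a :+ c) :+ (b :+ d)) refl (f x) (g x) (∑ xs f) (∑ xs g))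

  ∏-* : ∀ (xs : List A) f g → ∏ xs (λ x → f x * g x) ≈ ∏ xs f * ∏ xs g
  ∏-* []       f g = sym (*-identityˡ 1#)
  ∏-* (x ∷ xs) f g = trans (*-congˡ (∏-* xs f g))
    (solve 4 (λ a b c d → (a :* b) :* (c :* d) := (a :* c) :* (b :* d)) refl (f x) (g x) (∏ xs f) (∏ xs g))

  ∑-*ˡ : ∀ (xs : List A) f r → ∑ xs (λ x → r * f x) ≈ r * ∑ xs f
  ∑-*ˡ []       f r = sym (zeroʳ r)
  ∑-*ˡ (x ∷ xs) f r = trans (+-congˡ (∑-*ˡ xs f r)) (sym (distribˡ r (f x) (∑ xs f)))

  ∑-*ʳ : ∀ (xs : List A) f r → ∑ xs (λ x → f x * r) ≈ ∑ xs f * r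
  ∑-*ʳ xs f r = trans (∑-cong xs (λ x _ → *-comm (f x) r)) (trans (∑-*ˡ xs f r) (*-comm r _))

  ∑-swap : ∀ (xs : List A) (ys : List B) (f : A → B → Carrier) →
           ∑ xs (λ x → ∑ ys (λ y → f x y)) ≈ ∑ ys (λ y → ∑ xs (λ x → f x y))
  ∑-swap []       ys f = sym (∑-zero ys (λ _ _ → refl))
  ∑-swap (x ∷ xs) ys f = trans (+-congˡ (∑-swap xs ys f)) (sym (∑-+ ys (f x) (λ y → ∑ xs (λ x → f x y))))

  ∑-map : ∀ (h : A → B) xs f → ∑ (map h xs) f ≈ ∑ xs (f ∘ h)
  ∑-map h []       f = refl
  ∑-map h (x ∷ xs) f = +-congˡ (∑-map h xs f)

  ∑-++ : ∀ (xs ys : List A) f → ∑ (xs ++ ys) f ≈ ∑ xs f + ∑ ys f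
  ∑-++ []       ys f = sym (+-identityˡ _)
  ∑-++ (x ∷ xs) ys f = trans (+-congˡ (∑-++ xs ys f)) (sym (+-assoc _ _ _))

  ∑-concatMap : ∀ (h : A → List B) xs f → ∑ (concatMap h xs) f ≈ ∑ xs (λ x → ∑ (h x) f)
  ∑-concatMap h []       f = refl
  ∑-concatMap h (x ∷ xs) f = trans (∑-++ (h x) (concatMap h xs) f) (+-congˡ (∑-concatMap h xs f))

  ∏-map : ∀ (h : A → B) xs f → ∏ (map h xs) f ≈ ∏ xs (f ∘ h)
  ∏-map h []       f = refl
  ∏-map h (x ∷ xs) f = *-congˡ (∏-map h xs f)

  ∏-↭ : ∀ {xs ys : List A} f → xs ↭ ys → ∏ xs f ≈ ∏ ys f
  ∏-↭ f ↭.refl         = refl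
  ∏-↭ f (↭.prep x p)   = *-congˡ (∏-↭ f p)
  ∏-↭ f (↭.swap x y p) = trans (*-congˡ (*-congˡ (∏-↭ f p)))
    (solve 3 (λ a b c → a :* (b :* c) := b :* (a :* c)) refl (f x) (f y) _)
  ∏-↭ f (↭.trans p q)  = trans (∏-↭ f p) (∏-↭ f q)

  -- The factor of the largest index stands first, so that the induction along decreasing insertion
  -- can split it off.
  ∏< : ℕ → (ℕ → Carrier) → Carrier
  ∏< zero    f = 1#
  ∏< (suc n) f = f n * ∏< n f

  ∏<-suc : ∀ n f → ∏< (suc n) f ≈ f 0 * ∏< n (f ∘ suc)
  ∏<-suc zero    f = refl
  ∏<-suc (suc n) f = trans (*-congˡ (∏<-suc n f))
    (solve 3 (λ a b c → a :* (b :* c) := b :* (a :* c)) refl (f (suc n)) (f 0) _)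

  ∏-allFin : ∀ n f → ∏ (allFin n) (f ∘ toℕ) ≈ ∏< n f
  ∏-allFin zero    f = refl
  ∏-allFin (suc n) f = trans
    (*-congˡ (trans (reflexive (≡.cong (λ is → ∏ is (f ∘ toℕ)) (≡.sym (map-tabulate {n = n} id suc))))
      (trans (∏-map suc (allFin n) (f ∘ toℕ)) (∏-allFin n (f ∘ suc)))))
    (sym (∏<-suc n f))

  [_]* : Bool → Carrier → Carrier
  [ b ]* r = if b then r else 0#

  ∑-filterᵇ : ∀ p (xs : List A) f → ∑ (filterᵇ p xs) f ≈ ∑ xs (λ x → [ p x ]* (f x))
  ∑-filterᵇ p []       f = refl
  ∑-filterᵇ p (x ∷ xs) f with p x
  ... | true  = +-congˡ (∑-filterᵇ p xs f)
  ... | false = trans (∑-filterᵇ p xs f) (sym (+-identityˡ _))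

  ∏-filterᵇ : ∀ p (xs : List A) f → ∏ (filterᵇ p xs) f ≈ ∏ xs (λ x → if p x then f x else 1#)
  ∏-filterᵇ p []       f = refl
  ∏-filterᵇ p (x ∷ xs) f with p x
  ... | true  = *-congˡ (∏-filterᵇ p xs f)
  ... | false = trans (∏-filterᵇ p xs f) (sym (*-identityˡ _))

  pow-length-filterᵇ : ∀ r p (xs : List A) →
                       pow r (length (filterᵇ p xs)) ≈ ∏ xs (λ x → if p x then r else 1#)
  pow-length-filterᵇ r p []       = refl
  pow-length-filterᵇ r p (x ∷ xs) with p x
  ... | true  = *-congˡ (pow-length-filterᵇ r p xs)
  ... | false = trans (pow-length-filterᵇ r p xs) (sym (*-identityˡ _))

-- Convolution of series

module MotzkinPaths {c ℓ} (R : CommutativeRing c ℓ) where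
  open CommutativeRing R
  open RingDefs R
  open BigSums R
  open import Relation.Binary.Reasoning.Setoid setoid
  open import Algebra.Solver.Ring.NaturalCoefficients.Default commutativeSemiring

  Series : Set c
  Series = ℕ → Carrier

  conv-suc : ∀ (a b : Series) p → conv a b (suc p) ≈ a 0 * b (suc p) + conv (a ∘ suc) b p
  conv-suc a b p = +-congˡ (reflexive (≡.cong sumL
    (≡.trans (map-applyUpTo suc (λ i → a i * b (suc p ∸ i)) (suc p))
             (≡.sym (map-upTo (λ i → a (suc i) * b (p ∸ i)) (suc p))))))

  conv-cong : ∀ {a a′ b b′ : Series} p → (∀ i → i ≤ p → a i ≈ a′ i) → (∀ i → i ≤ p → b i ≈ b′ i) →
              conv a b p ≈ conv a′ b′ p
  conv-cong zero    ea eb = +-congʳ (*-cong (ea 0 z≤n) (eb 0 z≤n))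
  conv-cong {a} {a′} {b} {b′} (suc p) ea eb = begin
    conv a b (suc p)                         ≈⟨ conv-suc a b p ⟩
    a 0 * b (suc p) + conv (a ∘ suc) b p     ≈⟨ +-cong (*-cong (ea 0 z≤n) (eb (suc p) ℕₚ.≤-refl))
                                                  (conv-cong p (λ i i≤ → ea (suc i) (s≤s i≤)) (λ i i≤ → eb i (ℕₚ.m≤n⇒m≤1+n i≤))) ⟩
    a′ 0 * b′ (suc p) + conv (a′ ∘ suc) b′ p ≈⟨ conv-suc a′ b′ p ⟨
    conv a′ b′ (suc p)                       ∎

  conv-congˡ : ∀ {a a′ : Series} b p → (∀ i → i ≤ p → a i ≈ a′ i) → conv a b p ≈ conv a′ b p
  conv-congˡ b p ea = conv-cong {b = b} p ea (λ _ _ → refl)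

  conv-+ˡ : ∀ (a a′ b : Series) p → conv (λ i → a i + a′ i) b p ≈ conv a b p + conv a′ b p
  conv-+ˡ a a′ b zero    = solve 3 (λ x y z → (x :+ y) :* z :+ con 0 := (x :* z :+ con 0) :+ (y :* z :+ con 0)) refl _ _ _
  conv-+ˡ a a′ b (suc p) = begin
    conv (λ i → a i + a′ i) b (suc p) ≈⟨ conv-suc _ b p ⟩
    (a 0 + a′ 0) * b (suc p) + conv (λ i → a (suc i) + a′ (suc i)) b p ≈⟨ +-congˡ (conv-+ˡ (a ∘ suc) (a′ ∘ suc) b p) ⟩
    (a 0 + a′ 0) * b (suc p) + (conv (a ∘ suc) b p + conv (a′ ∘ suc) b p)
      ≈⟨ solve 5 (λ x y z u v → (x :+ y) :* z :+ (u :+ v) := (x :* z :+ u) :+ (y :* z :+ v)) refl _ _ _ _ _ ⟩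
    (a 0 * b (suc p) + conv (a ∘ suc) b p) + (a′ 0 * b (suc p) + conv (a′ ∘ suc) b p) ≈⟨ +-cong (conv-suc a b p) (conv-suc a′ b p) ⟨
    conv a b (suc p) + conv a′ b (suc p) ∎

  conv-*ˡ : ∀ r (a b : Series) p → conv (λ i → r * a i) b p ≈ r * conv a b p
  conv-*ˡ r a b p = trans (∑-cong (upTo (suc p)) (λ i _ → *-assoc r (a i) (b (p ∸ i))))
                          (∑-*ˡ (upTo (suc p)) (λ i → a i * b (p ∸ i)) r)

  conv-*ʳ : ∀ r (a b : Series) p → conv a (λ i → r * b i) p ≈ r * conv a b p
  conv-*ʳ r a b p = trans (∑-cong (upTo (suc p)) (λ i _ →
      solve 3 (λ x y z → x :* (y :* z) := y :* (x :* z)) refl (a i) r (b (p ∸ i))))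
    (∑-*ˡ (upTo (suc p)) (λ i → a i * b (p ∸ i)) r)

  conv-assoc : ∀ (a b d : Series) p → conv (conv a b) d p ≈ conv a (conv b d) p
  conv-assoc a b d zero    = solve 3 (λ x y z → (x :* y :+ con 0) :* z :+ con 0 := x :* (y :* z :+ con 0) :+ con 0) refl _ _ _
  conv-assoc a b d (suc p) = begin
    conv (conv a b) d (suc p) ≈⟨ conv-suc (conv a b) d p ⟩
    (a 0 * b 0 + 0#) * d (suc p) + conv (conv a b ∘ suc) d p
      ≈⟨ +-congˡ (conv-congˡ d p (λ i _ → conv-suc a b i)) ⟩
    (a 0 * b 0 + 0#) * d (suc p) + conv (λ i → a 0 * b (suc i) + conv (a ∘ suc) b i) d p
      ≈⟨ +-congˡ (trans (conv-+ˡ (λ i → a 0 * b (suc i)) (conv (a ∘ suc) b) d p)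
           (+-cong (conv-*ˡ (a 0) (b ∘ suc) d p) (conv-assoc (a ∘ suc) b d p))) ⟩
    (a 0 * b 0 + 0#) * d (suc p) + (a 0 * conv (b ∘ suc) d p + conv (a ∘ suc) (conv b d) p)
      ≈⟨ solve 5 (λ x y z u v → (x :* y :+ con 0) :* z :+ (x :* u :+ v) := x :* (y :* z :+ u) :+ v) refl _ _ _ _ _ ⟩
    a 0 * (b 0 * d (suc p) + conv (b ∘ suc) d p) + conv (a ∘ suc) (conv b d) p
      ≈⟨ +-congʳ (*-congˡ (conv-suc b d p)) ⟨
    a 0 * conv b d (suc p) + conv (a ∘ suc) (conv b d) p ≈⟨ conv-suc a (conv b d) p ⟨
    conv a (conv b d) (suc p) ∎

  conv-sucʳ : ∀ (a b : Series) p → conv a b (suc p) ≈ conv a (b ∘ suc) p + a (suc p) * b 0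
  conv-sucʳ a b zero    = solve 2 (λ x y → x :+ (y :+ con 0) := (x :+ con 0) :+ y) refl _ _
  conv-sucʳ a b (suc p) = begin
    conv a b (suc (suc p)) ≈⟨ conv-suc a b (suc p) ⟩
    a 0 * b (suc (suc p)) + conv (a ∘ suc) b (suc p) ≈⟨ +-congˡ (conv-sucʳ (a ∘ suc) b p) ⟩
    a 0 * b (suc (suc p)) + (conv (a ∘ suc) (b ∘ suc) p + a (suc (suc p)) * b 0) ≈⟨ +-assoc _ _ _ ⟨
    (a 0 * b (suc (suc p)) + conv (a ∘ suc) (b ∘ suc) p) + a (suc (suc p)) * b 0 ≈⟨ +-congʳ (conv-suc a (b ∘ suc) p) ⟨
    conv a (b ∘ suc) (suc p) + a (suc (suc p)) * b 0 ∎

  conv-comm : ∀ (a b : Series) p → conv a b p ≈ conv b a p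
  conv-comm a b zero    = +-congʳ (*-comm _ _)
  conv-comm a b (suc p) = begin
    conv a b (suc p)                     ≈⟨ conv-suc a b p ⟩
    a 0 * b (suc p) + conv (a ∘ suc) b p ≈⟨ +-cong (*-comm _ _) (conv-comm (a ∘ suc) b p) ⟩
    b (suc p) * a 0 + conv b (a ∘ suc) p ≈⟨ +-comm _ _ ⟩
    conv b (a ∘ suc) p + b (suc p) * a 0 ≈⟨ conv-sucʳ b a p ⟨
    conv b a (suc p)                     ∎

  -- Multiplication by t.
  shift : Series → Series
  shift a zero    = 0#
  shift a (suc p) = a p

  conv-shiftˡ : ∀ (a b : Series) p → conv (shift a) b p ≈ shift (conv a b) p
  conv-shiftˡ a b zero    = solve 1 (λ x → con 0 :* x :+ con 0 := con 0) refl _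
  conv-shiftˡ a b (suc p) = trans (conv-suc (shift a) b p) (trans (+-congʳ (zeroˡ _)) (+-identityˡ _))

  -- Tails of the J-fraction

  module _ (γ β : ℕ → Carrier) where
    open JFrac γ β renaming (T to approx)

    J : ℕ → Series
    J k m = approx m k m

    approx-stable : ∀ {n m} k → m ≤ n → approx n k m ≈ J k m
    approx-stable {zero}  k z≤n = refl
    approx-stable {suc n} {m} k m≤ with m ℕₚ.≤? n
    ... | yes m≤n rewrite T⇒≡true (ℕₚ.≤⇒≤ᵇ m≤n) = approx-stable k m≤n
    ... | no  m≰n rewrite ℕₚ.≤-antisym m≤ (ℕₚ.≰⇒> m≰n) = refl

    -- The equation f = 1 + γ t f + β t² f g in degree `suc m`, where f and g are the tails at
    -- levels `k` and `suc k`.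
    J-suc : ∀ k m → J k (suc m) ≈ γ k * J k m + β (suc k) * shift (conv (J k) (J (suc k))) m
    J-suc k zero    = +-congˡ (sym (zeroʳ _))
    J-suc k (suc m) rewrite ¬T⇒≡false (ℕₚ.<-irrefl ≡.refl ∘ ℕₚ.≤ᵇ⇒≤ (suc m) m) = +-congˡ (*-congˡ (conv-cong m
      (λ i i≤ → approx-stable k (ℕₚ.m≤n⇒m≤1+n i≤)) (λ i i≤ → approx-stable (suc k) (ℕₚ.m≤n⇒m≤1+n i≤))))

  -- Motzkin paths and first passage

  module _ (γ a b : ℕ → Carrier) where

    -- Weighted Motzkin paths of length n from height k to height 0: a level step at height k has weight γ k,
    -- a rise from k has weight a k, a fall to k has weight b k.
    paths : ℕ → ℕ → Carrier
    paths zero    zero    = 1#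
    paths zero    (suc k) = 0#
    paths (suc n) k       = γ k * paths n k + a k * paths n (suc k) + down k
      where
      down : ℕ → Carrier
      down zero    = 0#
      down (suc k) = b k * paths n k

    module _ (β : ℕ → Carrier) (β≈ : ∀ k → β (suc k) ≈ a k * b k) where

      private
        P : ℕ → Series
        P k m = paths m k

        Jᵏ : ℕ → Series
        Jᵏ = J γ β

        JJ : ℕ → Series
        JJ k = conv (Jᵏ k) (Jᵏ (suc k))

        -- Cuts a path from height `suc k` at its first visit to height `k`: an excursion that stays
        -- at `suc k` or above, accounted for by the tail `Jᵏ (suc k)`, then the fall, which gives
        -- `b k` and the shift, then a path from `k`.
        FirstVisit : ℕ → ℕ → Set ℓ
        FirstVisit k n = paths n (suc k) ≈ b k * shift (conv (Jᵏ (suc k)) (P k)) n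

        shift-cong : ∀ {f g : Series} n → (∀ m → m < n → f m ≈ g m) → shift f n ≈ shift g n
        shift-cong zero    eq = refl
        shift-cong (suc n) eq = eq n ℕₚ.≤-refl

        -- First passage applied twice, down to `suc k` and then to `k`; commutativity and
        -- associativity collect the two excursion series into one product.
        twoFalls : ∀ n k → (∀ i k → i ≤ n → FirstVisit k i) →
          paths n (suc (suc k)) ≈ b (suc k) * (b k * shift (shift (conv (JJ (suc k)) (P k))) n)
        twoFalls zero    k fv = trans (sym (zeroʳ _)) (*-congˡ (sym (zeroʳ _)))
        twoFalls (suc n) k fv = trans (fv (suc n) (suc k) ℕₚ.≤-refl) (*-congˡ (begin
            conv J″ (P (suc k)) n                        ≈⟨ conv-cong n (λ _ _ → refl) (λ i i≤n → fv i k (ℕₚ.m≤n⇒m≤1+n i≤n)) ⟩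
            conv J″ (λ m → b k * shift (conv J′ (P k)) m) n ≈⟨ conv-*ʳ (b k) J″ (shift (conv J′ (P k))) n ⟩
            b k * conv J″ (shift (conv J′ (P k))) n      ≈⟨ *-congˡ (conv-comm J″ _ n) ⟩
            b k * conv (shift (conv J′ (P k))) J″ n      ≈⟨ *-congˡ (conv-shiftˡ (conv J′ (P k)) J″ n) ⟩
            b k * shift (conv (conv J′ (P k)) J″) n      ≈⟨ *-congˡ (shift-cong n λ m _ → trans (conv-comm _ J″ m)
                  (trans (sym (conv-assoc J″ J′ (P k) m)) (conv-congˡ (P k) m (λ i _ → conv-comm J″ J′ i)))) ⟩
            b k * shift (conv (conv J′ J″) (P k)) n      ∎))
          where
          J′ = Jᵏ (suc k)
          J″ = Jᵏ (suc (suc k))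

        -- The functional equation of the tail at `suc k`, multiplied by the path series at `k`. Its
        -- three terms are those that arise from the first step of a path from `suc k`.
        conv-Jᵏ : ∀ k n → conv (Jᵏ (suc k)) (P k) n ≈
          paths n k + (γ (suc k) * shift (conv (Jᵏ (suc k)) (P k)) n
                       + β (suc (suc k)) * shift (shift (conv (JJ (suc k)) (P k))) n)
        conv-Jᵏ k zero = solve 3 (λ p g b → con 1 :* p :+ con 0 := p :+ (g :* con 0 :+ b :* con 0)) refl _ _ _
        conv-Jᵏ k (suc n) = begin
          conv J′ (P k) (suc n) ≈⟨ conv-suc J′ (P k) n ⟩
          1# * P k (suc n) + conv (J′ ∘ suc) (P k) n
            ≈⟨ +-cong (*-identityˡ _) (trans (conv-congˡ (P k) n (λ i _ → J-suc γ β k′ i))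
                (trans (conv-+ˡ (λ i → γ k′ * J′ i) (λ i → β (suc k′) * shift (JJ k′) i) (P k) n)
                (+-cong (conv-*ˡ (γ k′) J′ (P k) n)
                        (trans (conv-*ˡ (β (suc k′)) (shift (JJ k′)) (P k) n) (*-congˡ (conv-shiftˡ (JJ k′) (P k) n)))))) ⟩
          P k (suc n) + (γ k′ * conv J′ (P k) n + β (suc k′) * shift (conv (JJ k′) (P k)) n) ∎
          where
          k′ = suc k
          J′ = Jᵏ k′

        -- Split by the first step. After a rise the path must come back by two first passages, and
        -- the rise together with the fall that undoes it gives `a · b`, which is β. Since
        -- `twoFalls` refers to all shorter lengths, the induction runs on the bound `N`.
        firstVisit : ∀ N n k → n ≤ N → FirstVisit k n
        firstVisit N       zero    k _         = sym (zeroʳ _)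
        firstVisit (suc N) (suc n) k (s≤s n≤N) = begin
          γ k′ * paths n k′ + a k′ * paths n (suc k′) + b k * paths n k
            ≈⟨ +-congʳ (+-cong (*-congˡ (firstVisit N n k n≤N))
                 (*-congˡ (twoFalls n k (λ i j i≤n → firstVisit N i j (ℕₚ.≤-trans i≤n n≤N))))) ⟩
          γ k′ * (b k * s₁) + a k′ * (b k′ * (b k * s₂)) + b k * paths n k
            ≈⟨ solve 7 (λ g b s a b′ s′ p → g :* (b :* s) :+ a :* (b′ :* (b :* s′)) :+ b :* p
                  := b :* (p :+ (g :* s :+ (a :* b′) :* s′))) refl (γ k′) (b k) s₁ (a k′) (b k′) s₂ (paths n k) ⟩
          b k * (paths n k + (γ k′ * s₁ + (a k′ * b k′) * s₂))
            ≈⟨ *-congˡ (+-congˡ (+-congˡ (*-congʳ (β≈ k′)))) ⟨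
          b k * (paths n k + (γ k′ * s₁ + β (suc k′) * s₂))
            ≈⟨ *-congˡ (conv-Jᵏ k n) ⟨
          b k * conv (Jᵏ k′) (P k) n ∎
          where
          k′ = suc k
          s₁ = shift (conv (Jᵏ k′) (P k)) n
          s₂ = shift (shift (conv (JJ k′) (P k))) n

        -- Height 0 has no falls, so by first passage from height 1 the path series satisfies the
        -- equation of the whole fraction.
        paths-J-≤ : ∀ N n → n ≤ N → paths n 0 ≈ Jᵏ 0 n
        paths-J-≤ N       zero    _         = refl
        paths-J-≤ (suc N) (suc n) (s≤s n≤N) = begin
          γ 0 * paths n 0 + a 0 * paths n 1 + 0#
            ≈⟨ +-congʳ (+-cong (*-congˡ (paths-J-≤ N n n≤N)) (*-congˡ (firstVisit n n 0 ℕₚ.≤-refl))) ⟩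
          γ 0 * Jᵏ 0 n + a 0 * (b 0 * shift (conv (Jᵏ 1) (P 0)) n) + 0#
            ≈⟨ solve 5 (λ g j a b s → g :* j :+ a :* (b :* s) :+ con 0 := g :* j :+ (a :* b) :* s) refl _ _ _ _ _ ⟩
          γ 0 * Jᵏ 0 n + (a 0 * b 0) * shift (conv (Jᵏ 1) (P 0)) n
            ≈⟨ +-congˡ (*-cong (sym (β≈ 0)) (shift-cong n (λ m m<n → trans (conv-comm (Jᵏ 1) (P 0) m)
                 (conv-congˡ (Jᵏ 1) m (λ i i≤m → paths-J-≤ N i (ℕₚ.≤-trans i≤m (ℕₚ.≤-trans (ℕₚ.<⇒≤ m<n) n≤N))))))) ⟩
          γ 0 * Jᵏ 0 n + β 1 * shift (conv (Jᵏ 0) (Jᵏ 1)) n ≈⟨ J-suc γ β 0 n ⟨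
          Jᵏ 0 (suc n) ∎

      paths-jfrac : ∀ n → paths n 0 ≈ jfracCoeff γ β n
      paths-jfrac n = paths-J-≤ n n ℕₚ.≤-refl

-- Weights of vertices and of choices

module Weights {c ℓ} (R : CommutativeRing c ℓ)
  (x₁ x₂ ỹ₁ y₂ u₁ u₂ ṽ₁ v₂ : CommutativeRing.Carrier R)
  (w : ℕ → CommutativeRing.Carrier R) where
  open CommutativeRing R
  open RingDefs R
  open BigSums R
  open MotzkinPaths R using (paths)
  open import Relation.Binary.Reasoning.Setoid setoid hiding (start)
  open import Algebra.Solver.Ring.NaturalCoefficients.Default commutativeSemiring using (solve; _:+_; _:*_; _:=_; con)

  private variable
    A : Set

  []*-true : ∀ {b r} → T b → [ b ]* r ≈ r
  []*-true {true} _ = refl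

  []*-false : ∀ {b r} → ¬ T b → [ b ]* r ≈ 0#
  []*-false {true}  f = ⊥-elim (f _)
  []*-false {false} f = refl

  []*-cong : ∀ {b r r′} → (T b → r ≈ r′) → [ b ]* r ≈ [ b ]* r′
  []*-cong {true}  e = e _
  []*-cong {false} e = refl

  []*-∧ : ∀ b b′ r q → [ b ]* (([ b′ ]* r) * q) ≈ r * [ b ∧ b′ ]* q
  []*-∧ true  true  r q = refl
  []*-∧ true  false r q = trans (zeroˡ q) (sym (zeroʳ r))
  []*-∧ false b′    r q = sym (zeroʳ r)

  []*-∑ : ∀ b (xs : List A) f → [ b ]* (∑ xs f) ≈ ∑ xs (λ x → [ b ]* (f x))
  []*-∑ true  xs f = refl
  []*-∑ false xs f = sym (∑-zero xs (λ _ _ → refl))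

  ∑-pick : ∀ {k : A → ℕ} {x xs ys f} → AllPairs (λ a b → k a < k b) xs → Pick x xs ys →
           (∀ {y zs} → Pick y xs zs → k y ≢ k x → f (y , zs) ≈ 0#) → ∑ (picks xs) f ≈ f (x , ys)
  ∑-pick {xs = x ∷ xs} {f = f} (x< ∷ srt) here f≈0 = trans
    (+-congˡ (trans (∑-map _ (picks xs) f) (∑-zero (picks xs) λ (y , zs) y∈ →
      let py = ∈-picks⁻ xs y∈ in f≈0 (there py) (<⇒≢ (All.lookup x< (Pick-∈ py)) ∘ ≡.sym))))
    (+-identityʳ _)
  ∑-pick {xs = z ∷ xs} {f = f} (z< ∷ srt) (there px) f≈0 = trans
    (+-cong (f≈0 here (<⇒≢ (All.lookup z< (Pick-∈ px))))
      (trans (∑-map _ (picks xs) f) (∑-pick srt px (λ py → f≈0 (there py)))))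
    (+-identityˡ _)

  ∑-picks-zero : ∀ {xs : List A} {f} → (∀ {y zs} → Pick y xs zs → f (y , zs) ≈ 0#) → ∑ (picks xs) f ≈ 0#
  ∑-picks-zero {xs = xs} f≈0 = ∑-zero (picks xs) (λ _ y∈ → f≈0 (∈-picks⁻ xs y∈))

  ∑-picks-proj₁ : ∀ (xs : List A) f → ∑ (picks xs) (f ∘ proj₁) ≈ ∑ xs f
  ∑-picks-proj₁ []       f = refl
  ∑-picks-proj₁ (x ∷ xs) f = +-congˡ (trans (∑-map _ (picks xs) (f ∘ proj₁)) (∑-picks-proj₁ xs f))

  fallWeight : Bool → Bool → Carrier
  fallWeight fall anti = if fall then (if anti then x₂ else u₂) else (if anti then x₁ else u₁)

  γ a b : ℕ → Carrier
  γ = gammaSeq x₂ y₂ u₂ v₂ w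
  a k = x₁ + natMul k u₁
  b k = ỹ₁ + natMul k ṽ₁

  module _ (p : View) (v : ℕ) where
    open View p

    -- `fallFactor` is the weight of the position `t v`, charged to its image `v`; the test
    -- `t v <ᵇ t (t v)` tells a double fall from a peak. `riseFactor` is the share of `v` itself as
    -- a fixed point, double rise or valley.
    riseFactor fallFactor ω : Carrier
    riseFactor = if s v ≡ᵇ v then w (nest v) else
      (if v <ᵇ s v then (if v <ᵇ t v then (if cmin v then ỹ₁ else ṽ₁) else (if rec v then y₂ else v₂)) else 1#)
    fallFactor = if v <ᵇ t v then fallWeight (t v <ᵇ t (t v)) (anti (t v)) else 1#
    ω = riseFactor * fallFactor

  Ω : ℕ → View → Carrier
  Ω i p = ∏< i (ω p)

  slotWeight : Slot → List Slot → Carrier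
  slotWeight x xs = fallWeight (fall x) (all (λ y → pos y <ᵇ pos x) xs)

  driseWeight : ℕ → List ℕ → Carrier
  driseWeight b bs = if all (_<ᵇ b) bs then y₂ else v₂

  valleyWeight : ℕ → ℕ → Carrier
  valleyWeight a b = if b ≡ᵇ a then ỹ₁ else ṽ₁

  coef : Core → Choice → Carrier
  coef C fixed             = w (length (Core.op C))
  coef C peak              = 1#
  coef C (drise b bs)      = driseWeight b bs
  coef C (dfall x xs)      = slotWeight x xs
  coef C (valley x xs b _) = slotWeight x xs * valleyWeight (start x) b

  -- The total weight of the falls still to be closed.
  potential : List Slot → Carrier
  potential []       = 1#
  potential (x ∷ xs) = (fallWeight (fall x) true + natMul (length xs) (fallWeight (fall x) false)) * potential xs

  potential-relink : ∀ b c xs → potential (map (relink b c) xs) ≈ potential xs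
  potential-relink b c []       = refl
  potential-relink b c (x ∷ xs) rewrite length-map (relink b c) xs = *-congˡ (potential-relink b c xs)

  -- Exactly one value is the largest. With at least two values the smallest contributes `v₂`, and
  -- its presence in the remainder does not affect which of the others is largest.
  ∑-driseWeight : ∀ b bs → AllPairs _<_ (b ∷ bs) →
                  ∑ (picks (b ∷ bs)) (λ (c , cs) → driseWeight c cs) ≈ y₂ + natMul (length bs) v₂
  ∑-driseWeight b []       _ = refl
  ∑-driseWeight b (c ∷ cs) (b<@(b<c ∷ _) ∷ srt)
    rewrite ¬T⇒≡false {c <ᵇ b} (<-asym b<c ∘ <ᵇ⇒< c b) = trans
      (+-congˡ (trans (∑-map (λ (d , ds) → d , b ∷ ds) (picks (c ∷ cs)) _)
        (trans (∑-cong (picks (c ∷ cs)) keep) (∑-driseWeight c cs srt))))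
      (solve 3 (λ x y z → x :+ (y :+ z) := y :+ (x :+ z)) refl v₂ y₂ (natMul (length cs) v₂))
    where
    keep : ∀ q → q ∈ picks (c ∷ cs) → driseWeight (proj₁ q) (b ∷ proj₂ q) ≈ driseWeight (proj₁ q) (proj₂ q)
    keep (d , ds) q∈ rewrite T⇒≡true (<⇒<ᵇ (All.lookup b< (Pick-∈ (∈-picks⁻ (c ∷ cs) q∈)))) = refl

  -- slotWeight lets values, in decreasing order, choose their positions; potential lets positions, in
  -- increasing order, choose their values.  Both give the same total.
  ∑-slotWeight : ∀ x xs → AllPairs (λ y z → pos y < pos z) (x ∷ xs) →
                 ∑ (picks (x ∷ xs)) (λ (y , ys) → slotWeight y ys * potential ys) ≈ potential (x ∷ xs)
  ∑-slotWeight x []       _ = solve 1 (λ r → r :* con 1 :+ con 0 := (r :+ con 0) :* con 1) refl _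
  ∑-slotWeight x (y ∷ ys) (x<@(x<y ∷ _) ∷ srt)
    rewrite ¬T⇒≡false {pos y <ᵇ pos x} (<-asym x<y ∘ <ᵇ⇒< _ _) = begin
      U * Φ + ∑ (map (λ (z , zs) → z , x ∷ zs) (picks (y ∷ ys))) (λ (z , zs) → slotWeight z zs * potential zs)
        ≈⟨ +-congˡ (trans (∑-map (λ (z , zs) → z , x ∷ zs) (picks (y ∷ ys)) _)
             (trans (∑-cong (picks (y ∷ ys)) keep)
             (trans (∑-*ˡ (picks (y ∷ ys)) (λ (z , zs) → slotWeight z zs * potential zs) (X + natMul (length ys) U))
               (*-congˡ (∑-slotWeight y ys srt))))) ⟩
      U * Φ + (X + natMul (length ys) U) * Φ
        ≈⟨ solve 4 (λ u f x k → u :* f :+ (x :+ k) :* f := (x :+ (u :+ k)) :* f) refl U Φ X (natMul (length ys) U) ⟩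
      (X + (U + natMul (length ys) U)) * Φ ∎
    where
    X = fallWeight (fall x) true
    U = fallWeight (fall x) false
    Φ = potential (y ∷ ys)
    keep : ∀ q → q ∈ picks (y ∷ ys) → slotWeight (proj₁ q) (x ∷ proj₂ q) * potential (x ∷ proj₂ q) ≈
           (X + natMul (length ys) U) * (slotWeight (proj₁ q) (proj₂ q) * potential (proj₂ q))
    keep (z , zs) q∈ with ∈-picks⁻ (y ∷ ys) q∈
    ... | pz rewrite T⇒≡true (<⇒<ᵇ (All.lookup x< (Pick-∈ pz))) | ≡.sym (suc-injective (Pick-length pz)) =
      solve 3 (λ a b c → a :* (b :* c) := b :* (a :* c)) refl _ _ _

  ∑-valleyWeight : ∀ {x bs cs} → Unique bs → Pick x bs cs →
                   ∑ (picks bs) (valleyWeight x ∘ proj₁) ≈ b (length cs)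
  ∑-valleyWeight {x} {bs} u px = trans (∑-picks-proj₁ bs (valleyWeight x)) (go u px)
    where
    others : ∀ cs → All (x ≢_) cs → ∑ cs (valleyWeight x) ≈ natMul (length cs) ṽ₁
    others []       []         = refl
    others (c ∷ cs) (x≢c ∷ x∉) rewrite ¬T⇒≡false (x≢c ∘ ≡.sym ∘ ≡ᵇ⇒≡ c x) = +-congˡ (others cs x∉)
    go : ∀ {bs cs} → Unique bs → Pick x bs cs → ∑ bs (valleyWeight x) ≈ ỹ₁ + natMul (length cs) ṽ₁
    go {cs = cs} (x∉ ∷ _) here rewrite T⇒≡true (≡⇒≡ᵇ x x ≡.refl) = +-congˡ (others cs x∉)
    go {c ∷ _} (c∉ ∷ u) (there px) rewrite ¬T⇒≡false (All.lookup c∉ (Pick-∈ px) ∘ ≡ᵇ⇒≡ c x) =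
      trans (+-congˡ (go u px)) (solve 3 (λ x y z → x :+ (y :+ z) := y :+ (x :+ z)) refl _ _ _)

  ∑-choices : ∀ C (f : Choice → Carrier) → ∑ (choices C) f ≈
    f fixed + (f peak + (∑ (picks (Core.ov C)) (λ (b , bs) → f (drise b bs))
      + (∑ (picks (Core.op C)) (λ (x , xs) → f (dfall x xs))
      + ∑ (picks (Core.op C)) (λ (x , xs) → ∑ (picks (Core.ov C)) (λ (b , bs) → f (valley x xs b bs))))))
  ∑-choices (core op ov _) f = +-congˡ $ +-congˡ $
    trans (∑-++ (map (λ (b , bs) → drise b bs) (picks ov)) _ f) $
    +-cong (∑-map _ (picks ov) f) $
    trans (∑-++ (map (λ (x , xs) → dfall x xs) (picks op)) _ f) $
    +-cong (∑-map _ (picks op) f) $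
    trans (∑-concatMap _ (picks op) f) $
    ∑-cong (picks op) λ (x , xs) _ → ∑-map _ (picks ov) f

  -- One insertion as one step of a Motzkin path

  module _ (v : ℕ) where
    private
      M = paths γ a b v
      M⁺ = paths γ a b (suc v)

    after : Core → Choice → Carrier
    after C c = coef C c * (potential (Core.op (next v C c)) * M (length (Core.op (next v C c))))

    -- Closing a slot is paid for by the old potential, through `∑-slotWeight`. The term
    -- `x₂ + natMul k u₂` of γ therefore comes from the slot that a double fall newly opens at `v`,
    -- the smallest of `suc k` positions; likewise a peak brings the factor `a` of its own slot.
    -- Double rises and the images of valleys contribute `y₂ + natMul k v₂` and `b k` directly.
    ∑-after : ∀ {n} C → Wf n (suc v) C → ∑ (choices C) (after C) ≈ potential (Core.op C) * M⁺ (length (Core.op C))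
    ∑-after (core [] ov _) W with ↭-empty-inv (↭-sym (Wf.starts W))
    ... | ≡.refl = solve 4 (λ w₀ m₀ x m₁ →
        w₀ :* (con 1 :* m₀) :+ (con 1 :* (((x :+ con 0) :* con 1) :* m₁) :+ con 0)
        := con 1 :* (w₀ :* m₀ :+ (x :+ con 0) :* m₁ :+ con 0)) refl (w 0) (M 0) x₁ (M 1)
    ∑-after (core (_ ∷ _) [] _) W with ↭-length (Wf.starts W)
    ... | ()
    ∑-after C@(core op@(x₀ ∷ xs₀) ov@(b₀ ∷ bs₀) _) W = begin
      ∑ (choices C) (after C) ≈⟨ ∑-choices C (after C) ⟩
      _ ≈⟨ +-cong fixed≈ (+-congˡ (+-cong drise≈ (+-cong dfall≈ valley≈))) ⟩
      w (suc k) * (Φ * M (suc k)) + (1# * (a (suc k) * Φ * M (suc (suc k)))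
        + (d * (Φ * M (suc k)) + (Φ * (f * M (suc k)) + Φ * (b k * M k))))
        ≈⟨ solve 9 (λ w₁ Φ m₁ a₁ m₂ d f b₁ m₀ →
             w₁ :* (Φ :* m₁) :+ (con 1 :* (a₁ :* Φ :* m₂) :+ (d :* (Φ :* m₁) :+ (Φ :* (f :* m₁) :+ Φ :* (b₁ :* m₀))))
             := Φ :* ((f :+ d :+ w₁) :* m₁ :+ a₁ :* m₂ :+ b₁ :* m₀)) refl
             (w (suc k)) Φ (M (suc k)) (a (suc k)) (M (suc (suc k))) d f (b k) (M k) ⟩
      Φ * ((f + d + w (suc k)) * M (suc k) + a (suc k) * M (suc (suc k)) + b k * M k) ∎
      where
      open Wf W
      k = length xs₀
      Φ = potential op
      d = y₂ + natMul k v₂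
      f = x₂ + natMul k u₂
      k≡ : length bs₀ ≡ k
      k≡ = suc-injective (≡.trans (≡.sym (↭-length starts)) (length-map start op))
      relinked : ∀ b c xs → potential (map (relink b c) xs) * M (length (map (relink b c) xs)) ≈ potential xs * M (length xs)
      relinked b c xs = *-cong (potential-relink b c xs) (reflexive (≡.cong M (length-map (relink b c) xs)))
      fixed≈ : after C fixed ≈ w (suc k) * (Φ * M (suc k))
      fixed≈ = *-congˡ (relinked v v op)
      drise≈ : ∑ (picks ov) (λ (b , bs) → after C (drise b bs)) ≈ d * (Φ * M (suc k))
      drise≈ = trans (∑-cong (picks ov) (λ (b , bs) _ → *-congˡ {driseWeight b bs} (relinked b v op)))
        (trans (∑-*ʳ (picks ov) (λ (b , bs) → driseWeight b bs) (Φ * M (suc k)))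
          (*-congʳ (trans (∑-driseWeight b₀ bs₀ ov-sorted) (+-congˡ (reflexive (≡.cong (λ j → natMul j v₂) k≡))))))
      dfall≈ : ∑ (picks op) (λ (x , xs) → after C (dfall x xs)) ≈ Φ * (f * M (suc k))
      dfall≈ = trans (∑-cong (picks op) term)
        (trans (∑-*ʳ (picks op) (λ (x , xs) → slotWeight x xs * potential xs) (f * M (suc k)))
          (*-congʳ (∑-slotWeight x₀ xs₀ op-sorted)))
        where
        term : ∀ q → q ∈ picks op → after C (dfall (proj₁ q) (proj₂ q)) ≈
               slotWeight (proj₁ q) (proj₂ q) * potential (proj₂ q) * (f * M (suc k))
        term (x , xs) q∈ rewrite length-map (relink v (start x)) xs | suc-injective (Pick-length (∈-picks⁻ op q∈)) =
          trans (*-congˡ (*-congʳ (*-congˡ (potential-relink v (start x) xs))))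
            (solve 4 (λ s f p m → s :* ((f :* p) :* m) := (s :* p) :* (f :* m)) refl _ _ _ _)
      valley≈ : ∑ (picks op) (λ (x , xs) → ∑ (picks ov) (λ (b , bs) → after C (valley x xs b bs))) ≈ Φ * (b k * M k)
      valley≈ = trans (∑-cong (picks op) term)
        (trans (∑-*ʳ (picks op) (λ (x , xs) → slotWeight x xs * potential xs) (b k * M k))
          (*-congʳ (∑-slotWeight x₀ xs₀ op-sorted)))
        where
        term : ∀ q → q ∈ picks op → ∑ (picks ov) (λ (b , bs) → after C (valley (proj₁ q) (proj₂ q) b bs)) ≈
               slotWeight (proj₁ q) (proj₂ q) * potential (proj₂ q) * (b k * M k)
        term (x , xs) q∈ = begin
          ∑ (picks ov) (λ (b , bs) → after C (valley x xs b bs))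
            ≈⟨ ∑-cong (picks ov) (λ (b , bs) _ → trans
                 (*-congˡ (trans (relinked b _ (map (relink v (start x)) xs)) (trans (relinked v (start x) xs)
                   (*-congˡ (reflexive (≡.cong M (≡.sym (suc-injective (Pick-length px)))))))))
                 (solve 4 (λ s y p m → (s :* y) :* (p :* m) := ((s :* p) :* m) :* y) refl
                   (slotWeight x xs) (valleyWeight (start x) b) (potential xs) (M k))) ⟩
          ∑ (picks ov) (λ (b , bs) → slotWeight x xs * potential xs * M k * valleyWeight (start x) b)
            ≈⟨ ∑-*ˡ (picks ov) (λ (b , bs) → valleyWeight (start x) b) (slotWeight x xs * potential xs * M k) ⟩
          slotWeight x xs * potential xs * M k * ∑ (picks ov) (valleyWeight (start x) ∘ proj₁)
            ≈⟨ *-congˡ (trans (∑-valleyWeight (sorted⇒Unique ov-sorted) (proj₂ pb))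
                 (reflexive (≡.cong b (≡.trans (≡.sym (suc-injective (Pick-length (proj₂ pb)))) k≡)))) ⟩
          slotWeight x xs * potential xs * M k * b k
            ≈⟨ solve 3 (λ s m b → s :* m :* b := s :* (b :* m)) refl _ _ _ ⟩
          slotWeight x xs * potential xs * (b k * M k) ∎
          where
          px = ∈-picks⁻ op q∈
          pb = ∈⇒Pick (∈-resp-↭ starts (∈-map⁺ start (Pick-∈ px)))

  -- The factor of a vertex as a sum over choices

  module _ (p : View) (v : ℕ) where
    open View p

    ω-fixed : s v ≡ v → t v ≡ v → ω p v ≈ w (nest v)
    ω-fixed sv tv rewrite T⇒≡true (≡⇒≡ᵇ _ _ sv) | <ᵇ-false (≤-reflexive tv) = *-identityʳ _

    ω-peak : s v < v → t v < v → ω p v ≈ 1#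
    ω-peak sv tv rewrite ≢⇒≡ᵇ-false (<⇒≢ sv) | <ᵇ-false (<⇒≤ sv) | <ᵇ-false (<⇒≤ tv) = *-identityʳ _

    ω-drise : v < s v → t v < v → ω p v ≈ (if rec v then y₂ else v₂)
    ω-drise sv tv rewrite ≢⇒≡ᵇ-false (<⇒≢ sv ∘ ≡.sym) | <ᵇ-true sv | <ᵇ-false (<⇒≤ tv) = *-identityʳ _

    ω-dfall : s v < v → v < t v → ω p v ≈ fallWeight (t v <ᵇ t (t v)) (anti (t v))
    ω-dfall sv tv rewrite ≢⇒≡ᵇ-false (<⇒≢ sv) | <ᵇ-false (<⇒≤ sv) | <ᵇ-true tv = *-identityˡ _

    ω-valley : v < s v → v < t v →
               ω p v ≈ fallWeight (t v <ᵇ t (t v)) (anti (t v)) * (if cmin v then ỹ₁ else ṽ₁)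
    ω-valley sv tv rewrite ≢⇒≡ᵇ-false (<⇒≢ sv ∘ ≡.sym) | <ᵇ-true sv | <ᵇ-true tv = *-comm _ _

  module _ {n v C P} (v<n : v < n) (V : Valid n (suc v) C P) {p} (L : Lawful n p) (hP : T (P p)) where
    open Core C
    open Valid V
    open Wf wf
    open View p
    open Lawful L

    private
      g : Choice → Carrier
      g c = [ matches v c p ]* (coef C c)

      fixed≈0 : s v ≢ v → g fixed ≈ 0#
      fixed≈0 ne = []*-false (ne ∘ ≡ᵇ⇒≡ (s v) v)

      peak≈0 : ¬ (s v < v × t v < v) → g peak ≈ 0#
      peak≈0 ne = []*-false λ h → let (h₁ , h₂) = T-∧⁻ {s v <ᵇ v} h in ne (<ᵇ⇒< (s v) v h₁ , <ᵇ⇒< (t v) v h₂)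

      drise≈0 : ∀ {b bs} → ¬ (s v ≡ b × t v < v) → g (drise b bs) ≈ 0#
      drise≈0 {b} ne = []*-false λ h → let (h₁ , h₂) = T-∧⁻ {s v ≡ᵇ b} h in ne (≡ᵇ⇒≡ (s v) b h₁ , <ᵇ⇒< (t v) v h₂)

      dfall≈0 : ∀ {x xs} → ¬ (s v < v × t v ≡ pos x) → g (dfall x xs) ≈ 0#
      dfall≈0 {x} ne = []*-false λ h → let (h₁ , h₂) = T-∧⁻ {s v <ᵇ v} h in
        ne (<ᵇ⇒< (s v) v h₁ , t≡⇒ (≡ᵇ⇒≡ (s (pos x)) v h₂))

      valley≈0 : ∀ {x xs b bs} → ¬ (s v ≡ b × t v ≡ pos x) → g (valley x xs b bs) ≈ 0#
      valley≈0 {x} {b = b} ne = []*-false λ h → let (h₁ , h₂) = T-∧⁻ {s v ≡ᵇ b} h in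
        ne (≡ᵇ⇒≡ (s v) b h₁ , t≡⇒ (≡ᵇ⇒≡ (s (pos x)) v h₂))

      ov≢ : s v ≤ v → ∀ {b bs} → Pick b ov bs → s v ≢ b
      ov≢ sv pb e = <⇒≱ (ov-≥ (Pick-∈ pb)) (≡.subst (_≤ v) e sv)

      op≢ : t v ≤ v → ∀ {x xs} → Pick x op xs → t v ≢ pos x
      op≢ tv px e = <⇒≱ (op-≥ (Pick-∈ px)) (≡.subst (_≤ v) e tv)

      ∑drise≈0 : (∀ {b bs} → Pick b ov bs → ¬ (s v ≡ b × t v < v)) → ∑ (picks ov) (λ (b , bs) → g (drise b bs)) ≈ 0#
      ∑drise≈0 ne = ∑-picks-zero {xs = ov} (λ {b} {bs} pb → drise≈0 {b} {bs} (ne pb))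

      ∑dfall≈0 : (∀ {x xs} → Pick x op xs → ¬ (s v < v × t v ≡ pos x)) → ∑ (picks op) (λ (x , xs) → g (dfall x xs)) ≈ 0#
      ∑dfall≈0 ne = ∑-picks-zero {xs = op} (λ {x} {xs} px → dfall≈0 {x} {xs} (ne px))

      ∑∑valley : Carrier
      ∑∑valley = ∑ (picks op) (λ (x , xs) → ∑ (picks ov) (λ (b , bs) → g (valley x xs b bs)))

      ∑∑valley≈0 : (∀ {x xs b bs} → Pick x op xs → Pick b ov bs → ¬ (s v ≡ b × t v ≡ pos x)) → ∑∑valley ≈ 0#
      ∑∑valley≈0 ne = ∑-picks-zero {xs = op} λ {x} {xs} px → ∑-picks-zero {xs = ov} λ {b} {bs} pb →
        valley≈0 {x} {xs} {b} {bs} (ne px pb)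

      sum₅ : ∀ {r₁ r₂ r₃ r₄ r₅ q₁ q₂ q₃ q₄ q₅} → r₁ ≈ q₁ → r₂ ≈ q₂ → r₃ ≈ q₃ → r₄ ≈ q₄ → r₅ ≈ q₅ →
             r₁ + (r₂ + (r₃ + (r₄ + r₅))) ≈ q₁ + (q₂ + (q₃ + (q₄ + q₅)))
      sum₅ e₁ e₂ e₃ e₄ e₅ = +-cong e₁ (+-cong e₂ (+-cong e₃ (+-cong e₄ e₅)))

      Result : Set ℓ
      Result = g fixed + (g peak + (∑ (picks ov) (λ (b , bs) → g (drise b bs))
                 + (∑ (picks op) (λ (x , xs) → g (dfall x xs)) + ∑∑valley))) ≈ ω p v

      fixed-case : s v ≡ v → Result
      fixed-case sv = trans
        (sum₅ ([]*-true (≡⇒≡ᵇ (s v) v sv)) (peak≈0 λ (h , _) → <⇒≢ h sv)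
          (∑drise≈0 λ pb (e , _) → ov≢ (≤-reflexive sv) pb e)
          (∑dfall≈0 λ px (h , _) → <⇒≢ h sv)
          (∑∑valley≈0 λ px pb (e , _) → ov≢ (≤-reflexive sv) pb e))
        (trans (solve 1 (λ r → r :+ (con 0 :+ (con 0 :+ (con 0 :+ con 0))) := r) refl _)
          (sym (trans (ω-fixed p v sv (t≡⇒ sv)) (reflexive (≡.cong w (nest-fixed v<n V L hP sv))))))

      peak-case : s v < v → t v < v → Result
      peak-case sv tv = trans
        (sum₅ (fixed≈0 (<⇒≢ sv)) ([]*-true (T-∧⁺ (<⇒<ᵇ sv) (<⇒<ᵇ tv)))
          (∑drise≈0 λ pb (e , _) → ov≢ (<⇒≤ sv) pb e)
          (∑dfall≈0 λ px (_ , e) → op≢ (<⇒≤ tv) px e)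
          (∑∑valley≈0 λ px pb (e , _) → ov≢ (<⇒≤ sv) pb e))
        (trans (solve 1 (λ r → con 0 :+ (r :+ (con 0 :+ (con 0 :+ con 0))) := r) refl _) (sym (ω-peak p v sv tv)))

      drise-case : v < s v → t v < v → Result
      drise-case sv tv with ∈⇒Pick (ov-intro v<n V L hP sv (≤-reflexive (t∘s v)))
      ... | bs , pb = trans
        (sum₅ (fixed≈0 (<⇒≢ sv ∘ ≡.sym)) (peak≈0 λ (h , _) → <-asym sv h)
          (trans (∑-pick {k = id} ov-sorted pb (λ {c} {cs} _ c≢ → drise≈0 {c} {cs} (c≢ ∘ ≡.sym ∘ proj₁)))
            ([]*-true (T-∧⁺ (≡⇒≡ᵇ (s v) (s v) ≡.refl) (<⇒<ᵇ tv))))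
          (∑dfall≈0 λ px (_ , e) → op≢ (<⇒≤ tv) px e)
          (∑∑valley≈0 λ px pb (_ , e) → op≢ (<⇒≤ tv) px e))
        (trans (solve 1 (λ r → con 0 :+ (con 0 :+ (r :+ (con 0 :+ con 0))) := r) refl _)
          (sym (trans (ω-drise p v sv tv) (reflexive (≡.cong (if_then y₂ else v₂) (≡.sym (rec-drise v<n V L hP pb ≡.refl)))))))

      fallWeight≡ : ∀ {x xs} → Pick x op xs → pos x ≡ t v → fallWeight (t v <ᵇ t (t v)) (anti (t v)) ≡ slotWeight x xs
      fallWeight≡ px e = ≡.sym (≡.cong₂ fallWeight
        (≡.trans (Sound.type (proj₁ (sound L hP)) (Pick-∈ px)) (≡.cong (λ a → a <ᵇ t a) e))
        (≡.trans (anti-fall v<n V L hP px (s≡⇒ (≡.sym e))) (≡.cong anti e)))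

      dfall-case : s v < v → v < t v → Result
      dfall-case sv tv with op-intro v<n V L hP tv (≤-reflexive (s∘t v))
      ... | x , x∈ , e with ∈⇒Pick x∈
      ...   | xs , px = trans
        (sum₅ (fixed≈0 (<⇒≢ sv)) (peak≈0 λ (_ , h) → <-asym tv h)
          (∑drise≈0 λ pb (e , _) → ov≢ (<⇒≤ sv) pb e)
          (trans (∑-pick {k = pos} op-sorted px (λ {y} {ys} _ y≢ → dfall≈0 {y} {ys} λ (_ , e′) → y≢ (≡.trans (≡.sym e′) (≡.sym e))))
            ([]*-true (T-∧⁺ (<⇒<ᵇ sv) (≡⇒≡ᵇ (s (pos x)) v (s≡⇒ (≡.sym e))))))
          (∑∑valley≈0 λ px pb (e , _) → ov≢ (<⇒≤ sv) pb e))
        (trans (solve 1 (λ r → con 0 :+ (con 0 :+ (con 0 :+ (r :+ con 0))) := r) refl _)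
          (sym (trans (ω-dfall p v sv tv) (reflexive (fallWeight≡ px e)))))

      valley-case : v < s v → v < t v → Result
      valley-case sv tv with op-intro v<n V L hP tv (≤-reflexive (s∘t v)) | ∈⇒Pick (ov-intro v<n V L hP sv (≤-reflexive (t∘s v)))
      ... | x , x∈ , e | bs , pb with ∈⇒Pick x∈
      ...   | xs , px = trans
        (sum₅ (fixed≈0 (<⇒≢ sv ∘ ≡.sym)) (peak≈0 λ (_ , h) → <-asym tv h)
          (∑drise≈0 λ pb (_ , h) → <-asym tv h)
          (∑dfall≈0 λ px (h , _) → <-asym sv h)
          (trans (∑-pick {k = pos} op-sorted px (λ {y} {ys} _ y≢ → ∑-picks-zero {xs = ov} λ {c} {cs} _ →
                    valley≈0 {y} {ys} {c} {cs} λ (_ , e′) → y≢ (≡.trans (≡.sym e′) (≡.sym e))))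
          (trans (∑-pick {k = id} ov-sorted pb (λ {c} {cs} _ c≢ → valley≈0 {x} {xs} {c} {cs} (c≢ ∘ ≡.sym ∘ proj₁)))
            ([]*-true (T-∧⁺ (≡⇒≡ᵇ (s v) (s v) ≡.refl) (≡⇒≡ᵇ (s (pos x)) v (s≡⇒ (≡.sym e))))))))
        (trans (solve 1 (λ r → con 0 :+ (con 0 :+ (con 0 :+ (con 0 :+ r))) := r) refl _)
          (sym (trans (ω-valley p v sv tv) (*-cong (reflexive (fallWeight≡ px e))
            (reflexive (≡.cong (if_then ỹ₁ else ṽ₁) (≡.sym (cmin-valley v<n V L hP px pb (s≡⇒ (≡.sym e)) ≡.refl))))))))

    -- Comparing `s v` and `t v` with `v` determines the kind of choice. The open value `s v` and
    -- the slot at `t v`, where the kind asks for them, occur once in their sorted lists, so a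
    -- single term survives.
    ω-choices : ∑ (choices C) (λ c → [ matches v c p ]* (coef C c)) ≈ ω p v
    ω-choices = trans (∑-choices C g) result
      where
      result : Result
      result with <-cmp (s v) v | <-cmp (t v) v
      ... | tri≈ _ sv _ | _           = fixed-case sv
      ... | tri< _ ne _ | tri≈ _ tv _ = ⊥-elim (ne (s≡⇒ tv))
      ... | tri> _ ne _ | tri≈ _ tv _ = ⊥-elim (ne (s≡⇒ tv))
      ... | tri< sv _ _ | tri< tv _ _ = peak-case sv tv
      ... | tri< sv _ _ | tri> _ _ tv = dfall-case sv tv
      ... | tri> _ _ sv | tri< tv _ _ = drise-case sv tv
      ... | tri> _ _ sv | tri> _ _ tv = valley-case sv tv

  -- Summation over all permutations with a given restriction

  module _ (n : ℕ) (ps : List View) (lawful : ∀ {p} → p ∈ ps → Lawful n p)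
    (leaf : ∀ {C P} → Valid n 0 C P → Core.op C ≡ [] → ∑ ps (λ p → [ P p ]* 1#) ≈ 1#) where

    -- Induction on the number `i` of vertices still to be inserted: expanding `ω` by `ω-choices`
    -- and exchanging the sums refines the class by the choice at the next vertex.
    class-sum : ∀ i {C P} → i ≤ n → Valid n i C P →
      ∑ ps (λ p → [ P p ]* (Ω i p)) ≈ potential (Core.op C) * paths γ a b i (length (Core.op C))
    class-sum zero {core [] _ _} _ V = trans (leaf V ≡.refl) (sym (*-identityˡ 1#))
    -- An open position would need an image below 0, so the class is empty; nor is there a path of
    -- length 0 from a positive height.
    class-sum zero {core (x ∷ xs) _ _} _ V = trans
      (∑-zero ps λ p p∈ → []*-false λ h → n≮0 (Compat.op-< (proj₂ (Valid.sound V (lawful p∈) h)) (here ≡.refl)))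
      (sym (zeroʳ _))
    class-sum (suc v) {C} {P} v<n V = begin
      ∑ ps (λ p → [ P p ]* (ω p v * Ω v p))
        ≈⟨ ∑-cong ps (λ p p∈ → []*-cong λ hP → *-congʳ (sym (ω-choices v<n V (lawful p∈) hP))) ⟩
      ∑ ps (λ p → [ P p ]* (∑ (choices C) (λ c → [ matches v c p ]* (coef C c)) * Ω v p))
        ≈⟨ ∑-cong ps (λ p _ → trans ([]*-cong {P p} λ _ → sym (∑-*ʳ (choices C) _ (Ω v p)))
             (trans ([]*-∑ (P p) (choices C) _) (∑-cong (choices C) λ c _ → []*-∧ (P p) (matches v c p) (coef C c) (Ω v p)))) ⟩
      ∑ ps (λ p → ∑ (choices C) (λ c → coef C c * [ P p ∧ matches v c p ]* (Ω v p)))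
        ≈⟨ ∑-swap ps (choices C) (λ p c → coef C c * [ P p ∧ matches v c p ]* (Ω v p)) ⟩
      ∑ (choices C) (λ c → ∑ ps (λ p → coef C c * [ P p ∧ matches v c p ]* (Ω v p)))
        ≈⟨ ∑-cong (choices C) (λ c c∈ → trans (∑-*ˡ ps _ (coef C c))
             (*-congˡ (class-sum v (<⇒≤ v<n) (next-Valid v<n V (∈-choices⁻ c∈))))) ⟩
      ∑ (choices C) (after v C) ≈⟨ ∑-after v C (Valid.wf V) ⟩
      potential (Core.op C) * paths γ a b (suc v) (length (Core.op C)) ∎

    ∑-Ω : ∑ ps (Ω n) ≈ paths γ a b n 0
    ∑-Ω = trans (class-sum n ≤-refl initial) (*-identityˡ _)
      where
      initial : Valid n n (core [] [] (λ _ → nothing)) (λ _ → true)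
      initial = record
        { wf = record
          { op-sorted = []
          ; ov-sorted = []
          ; op-≥ = λ ()
          ; ov-≥ = λ ()
          ; op-<n = λ ()
          ; ov-<n = λ ()
          ; starts = ↭-refl
          ; op-out = λ ()
          ; out-≥ = λ ()
          ; out-<n = λ ()
          ; out-dom = λ n≤a a<n → ⊥-elim (<⇒≱ a<n n≤a)
          ; out-cod = λ n≤b b<n → ⊥-elim (<⇒≱ b<n n≤b)
          }
        ; sound = λ L _ → record { edge = λ () ; path = λ () ; type = λ () } , compat (λ ()) (λ ()) (λ ())
        ; complete = λ _ _ → _
        }

-- Sums supported at one vector

module _ {c ℓ} (R : CommutativeRing c ℓ) where
  open CommutativeRing R
  open BigSums R

  ∑-unique : ∀ {A : Set} {x xs} {f : A → Carrier} → Unique xs → x ∈ xs → (∀ y → y ≢ x → f y ≈ 0#) → ∑ xs f ≈ f x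
  ∑-unique {xs = x ∷ xs} (x∉ ∷ _) (here ≡.refl) f≈0 =
    trans (+-congˡ (∑-zero xs λ y y∈ → f≈0 y (All.lookup x∉ y∈ ∘ ≡.sym))) (+-identityʳ _)
  ∑-unique {xs = y ∷ xs} (y∉ ∷ u) (there x∈) f≈0 =
    trans (+-cong (f≈0 y (All.lookup y∉ x∈)) (∑-unique u x∈ f≈0)) (+-identityˡ _)

  -- Rests on `τ` occurring exactly once in the enumeration: one head in `allFin n`, then one tail.
  ∑-allVecs : ∀ {n m} (τ : Vec (Fin n) m) {f} → (∀ ρ → ρ ≢ τ → f ρ ≈ 0#) → ∑ (allVecs n m) f ≈ f τ
  ∑-allVecs []      f≈0 = +-identityʳ _
  ∑-allVecs {n} {suc m} (i ∷ τ) {f} f≈0 = trans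
    (∑-concatMap _ (allFin n) f)
    (trans (∑-unique (allFin⁺ n) (∈-allFin i) λ j j≢i →
             trans (∑-map (j ∷_) (allVecs n m) f) (∑-zero (allVecs n m) λ ρ _ → f≈0 (j ∷ ρ) λ { ≡.refl → j≢i ≡.refl }))
      (trans (∑-map (i ∷_) (allVecs n m) f) (∑-allVecs τ λ ρ ρ≢τ → f≈0 (i ∷ ρ) λ { ≡.refl → ρ≢τ ≡.refl })))

module Proof {c ℓ} (R : CommutativeRing c ℓ)
  (x₁ x₂ ỹ₁ y₂ u₁ u₂ ṽ₁ v₂ : CommutativeRing.Carrier R)
  (w : ℕ → CommutativeRing.Carrier R) where
  open CommutativeRing R
  open RingDefs R
  open BigSums R
  open MotzkinPaths R using (paths; paths-jfrac)
  open Weights R x₁ x₂ ỹ₁ y₂ u₁ u₂ ṽ₁ v₂ w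
  open import Relation.Binary.Reasoning.Setoid setoid hiding (start)
  open import Algebra.Solver.Ring.NaturalCoefficients.Default commutativeSemiring using (solve; _:*_; _:=_; con)

  leaf : ∀ {n C P} → Valid n 0 C P → Core.op C ≡ [] → ∑ (views n) (λ p → [ P p ]* 1#) ≈ 1#
  leaf {n} {C} {P} V e = begin
    ∑ (views n) (λ p → [ P p ]* 1#)                          ≈⟨ ∑-map view (perms n) _ ⟩
    ∑ (perms n) (λ σ → [ P (view σ) ]* 1#)                   ≈⟨ ∑-filterᵇ isPerm (allVecs n n) _ ⟩
    ∑ (allVecs n n) (λ σ → [ isPerm σ ]* ([ P (view σ) ]* 1#)) ≈⟨ ∑-allVecs R τ vanish ⟩
    [ isPerm τ ]* ([ P (view τ) ]* 1#)                       ≈⟨ []*-true (completion-isPerm V e) ⟩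
    [ P (view τ) ]* 1#                                       ≈⟨ []*-true (completion-P V e) ⟩
    1# ∎
    where
    τ = completion V e
    vanish : ∀ σ → σ ≢ τ → [ isPerm σ ]* ([ P (view σ) ]* 1#) ≈ 0#
    vanish σ σ≢τ = trans
      ([]*-cong {isPerm σ} λ perm → []*-false λ hP → σ≢τ (completion-unique V e σ perm hP))
      (zero-[]* (isPerm σ))
      where
      zero-[]* : ∀ b → [ b ]* 0# ≈ 0#
      zero-[]* true  = refl
      zero-[]* false = refl

  -- The weight of a permutation as a product over vertices

  ι : Bool → Carrier → Carrier
  ι b r = if b then r else 1#

  -- The nine factors of `weight` at one vertex, in the order of the definition. The statistics are
  -- arguments, so that those of `Stats` can be exchanged for those of the view and then decided by
  -- cases.
  local : (sv tv : ℕ) (rc an mn : Bool) (k v : ℕ) → Carrier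
  local sv tv rc an mn k v =
      ι (pk ∧ (an ∧ not rc)) x₁ * ι (df ∧ (an ∧ not rc)) x₂ * ι (vl ∧ mn) ỹ₁ * ι (dr ∧ (rc ∧ not an)) y₂
    * ι (pk ∧ (not rc ∧ not an)) u₁ * ι (df ∧ (not rc ∧ not an)) u₂ * ι (vl ∧ not mn) ṽ₁
    * ι (dr ∧ (not rc ∧ not an)) v₂ * ι (sv ≡ᵇ v) (w k)
    where
    pk = (tv <ᵇ v) ∧ (sv <ᵇ v)
    vl = (v <ᵇ tv) ∧ (v <ᵇ sv)
    dr = (tv <ᵇ v) ∧ (v <ᵇ sv)
    df = (v <ᵇ tv) ∧ (sv <ᵇ v)

  local-cong : ∀ {s s′ t t′ r r′ a a′ m m′ k k′} v → s ≡ s′ → t ≡ t′ → r ≡ r′ → a ≡ a′ → m ≡ m′ → k ≡ k′ →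
               local s t r a m k v ≡ local s′ t′ r′ a′ m′ k′ v
  local-cong v ≡.refl ≡.refl ≡.refl ≡.refl ≡.refl ≡.refl = ≡.refl

  -- The factor of fallFactor, attached to the position instead of the value.
  ownFall : View → ℕ → Carrier
  ownFall p v = ι (s v <ᵇ v) (fallWeight (v <ᵇ t v) (anti v))
    where open View p

  module _ {n p} (L : Lawful n p) {v} (v<n : v < n) where
    open View p
    open Lawful L

    -- The type of `v` leaves at most two factors that can differ from 1; `fall⇒¬rec` or
    -- `rise⇒¬anti` then reduces their conditions to one Boolean and its negation.
    local-split : local (s v) (t v) (rec v) (anti v) (cmin v) (nest v) v ≈ riseFactor p v * ownFall p v
    local-split with <-cmp (s v) v | <-cmp (t v) v
    ... | tri≈ _ sv _ | tri< tv _ _ = ⊥-elim (<⇒≢ tv (t≡⇒ sv))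
    ... | tri≈ _ sv _ | tri> _ _ tv = ⊥-elim (<⇒≢ tv (≡.sym (t≡⇒ sv)))
    ... | tri< _ ne _ | tri≈ _ tv _ = ⊥-elim (ne (s≡⇒ tv))
    ... | tri> _ ne _ | tri≈ _ tv _ = ⊥-elim (ne (s≡⇒ tv))
    ... | tri≈ _ sv _ | tri≈ _ tv _
      rewrite <ᵇ-false (≤-reflexive tv) | <ᵇ-false (≤-reflexive (≡.sym tv))
            | <ᵇ-false (≤-reflexive sv) | <ᵇ-false (≤-reflexive (≡.sym sv)) | T⇒≡true (≡⇒≡ᵇ _ _ sv) =
      solve 1 (λ r → con 1 :* con 1 :* con 1 :* con 1 :* con 1 :* con 1 :* con 1 :* con 1 :* r := r :* con 1) refl _
    ... | tri< sv _ _ | tri< tv _ _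
      rewrite <ᵇ-true tv | <ᵇ-false (<⇒≤ tv) | <ᵇ-true sv | <ᵇ-false (<⇒≤ sv) | ≢⇒≡ᵇ-false (<⇒≢ sv)
            | fall⇒¬rec L v<n sv with anti v
    ...   | true  = solve 1 (λ r → r :* con 1 :* con 1 :* con 1 :* con 1 :* con 1 :* con 1 :* con 1 :* con 1 := con 1 :* r) refl _
    ...   | false = solve 1 (λ r → con 1 :* con 1 :* con 1 :* con 1 :* r :* con 1 :* con 1 :* con 1 :* con 1 := con 1 :* r) refl _
    local-split | tri< sv _ _ | tri> _ _ tv
      rewrite <ᵇ-true tv | <ᵇ-false (<⇒≤ tv) | <ᵇ-true sv | <ᵇ-false (<⇒≤ sv) | ≢⇒≡ᵇ-false (<⇒≢ sv)
            | fall⇒¬rec L v<n sv with anti v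
    ...   | true  = solve 1 (λ r → con 1 :* r :* con 1 :* con 1 :* con 1 :* con 1 :* con 1 :* con 1 :* con 1 := con 1 :* r) refl _
    ...   | false = solve 1 (λ r → con 1 :* con 1 :* con 1 :* con 1 :* con 1 :* r :* con 1 :* con 1 :* con 1 := con 1 :* r) refl _
    local-split | tri> _ ne sv | tri< tv _ _
      rewrite <ᵇ-true tv | <ᵇ-false (<⇒≤ tv) | <ᵇ-true sv | <ᵇ-false (<⇒≤ sv) | ≢⇒≡ᵇ-false ne
            | rise⇒¬anti L v<n sv with rec v
    ...   | true  = solve 1 (λ r → con 1 :* con 1 :* con 1 :* r :* con 1 :* con 1 :* con 1 :* con 1 :* con 1 := r :* con 1) refl _
    ...   | false = solve 1 (λ r → con 1 :* con 1 :* con 1 :* con 1 :* con 1 :* con 1 :* con 1 :* r :* con 1 := r :* con 1) refl _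
    local-split | tri> _ ne sv | tri> _ _ tv
      rewrite <ᵇ-true tv | <ᵇ-false (<⇒≤ tv) | <ᵇ-true sv | <ᵇ-false (<⇒≤ sv) | ≢⇒≡ᵇ-false ne
        with cmin v
    ...   | true  = solve 1 (λ r → con 1 :* con 1 :* r :* con 1 :* con 1 :* con 1 :* con 1 :* con 1 :* con 1 := r :* con 1) refl _
    ...   | false = solve 1 (λ r → con 1 :* con 1 :* con 1 :* con 1 :* con 1 :* con 1 :* r :* con 1 :* con 1 := r :* con 1) refl _

  module _ {n : ℕ} where

    -- Restates the summand local to `Qtilde`, with which it agrees by computation.
    weight : Vec (Fin n) n → Carrier
    weight σ = pow x₁ eareccpeak * pow x₂ eareccdfall * pow ỹ₁ minval * pow y₂ ereccdrise
             * pow u₁ nrcpeak * pow u₂ nrcdfall * pow ṽ₁ nminval * pow v₂ nrcdrise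
             * prodL (map (λ i → w (psnest i)) fixedPoints)
      where open Stats σ

    weight-local : ∀ σ → let open View (view σ) in
      weight σ ≈ ∏ (allFin n) (λ i → let v = toℕ i in local (s v) (t v) (rec v) (anti v) (cmin v) (nest v) v)
    weight-local σ = trans
      (count* (λ i → isPeak i ∧ isExclAntirecord i) x₁ ∙ (λ i → isDFall i ∧ isExclAntirecord i) , x₂
        ∙ (λ i → isValley i ∧ isCycleMin i) , ỹ₁ ∙ (λ i → isDRise i ∧ isExclRecord i) , y₂
        ∙ (λ i → isPeak i ∧ isNeither i) , u₁ ∙ (λ i → isDFall i ∧ isNeither i) , u₂
        ∙ (λ i → isValley i ∧ not (isCycleMin i)) , ṽ₁ ∙ (λ i → isDRise i ∧ isNeither i) , v₂
        ∙w)
      (∏-cong (allFin n) λ i → reflexive (≡.sym (local-cong (toℕ i)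
        (extend-toℕ _ ap i) (extend-toℕ _ inv i) (extend-toℕ _ isRecord i) (extend-toℕ _ isAntirecord i)
        (extend-toℕ _ isCycleMin i) (extend-toℕ _ psnest i))))
      where
      open Stats σ
      is = allFin n
      count* : ∀ q r → pow r (count q) ≈ ∏ is (λ i → ι (q i) r)
      count* q r = pow-length-filterᵇ r q is
      infixl 5 _∙_,_ _∙w
      _∙_,_ : ∀ {z f} → z ≈ ∏ is f → ∀ q r → z * pow r (count q) ≈ ∏ is (λ i → f i * ι (q i) r)
      e ∙ q , r = trans (*-cong e (count* q r)) (sym (∏-* is _ _))
      _∙w : ∀ {z f} → z ≈ ∏ is f → z * ∏ fixedPoints (w ∘ psnest) ≈ ∏ is (λ i → f i * ι (isFixed i) (w (psnest i)))
      e ∙w = trans (*-cong e (∏-filterᵇ isFixed is (w ∘ psnest))) (sym (∏-* is _ _))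

    module _ (σ : Vec (Fin n) n) (perm : T (isPerm σ)) where
      private
        p = view σ
        L = view-lawful σ perm
      open View p
      open Lawful L

      -- Substituting the inverse image for the index turns a product over positions into one over
      -- values; `s (t v) ≡ v` then identifies the factors.
      ∏-ownFall : ∏ (allFin n) (ownFall p ∘ toℕ) ≈ ∏ (allFin n) (fallFactor p ∘ toℕ)
      ∏-ownFall = begin
        ∏ (allFin n) (ownFall p ∘ toℕ)                ≈⟨ ∏-↭ (ownFall p ∘ toℕ) reindex ⟨
        ∏ (map (σ⁻¹ σ perm) (allFin n)) (ownFall p ∘ toℕ) ≈⟨ ∏-map (σ⁻¹ σ perm) (allFin n) _ ⟩
        ∏ (allFin n) (ownFall p ∘ toℕ ∘ σ⁻¹ σ perm)   ≈⟨ ∏-cong (allFin n) (λ i → reflexive (≡.trans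
             (≡.cong (ownFall p) (≡.sym (t-toℕ σ perm i)))
             (≡.cong (λ a → ι (a <ᵇ t (toℕ i)) (fallWeight (t (toℕ i) <ᵇ t (t (toℕ i))) (anti (t (toℕ i))))) (s∘t (toℕ i))))) ⟩
        ∏ (allFin n) (fallFactor p ∘ toℕ) ∎
        where
        reindex : map (σ⁻¹ σ perm) (allFin n) ↭ allFin n
        reindex = sameElements⇒↭
          (Unique-map⁺ (λ {i} {j} e → ≡.trans (≡.sym (σ∘σ⁻¹ σ perm i)) (≡.trans (≡.cong (lookup σ) e) (σ∘σ⁻¹ σ perm j))) (allFin⁺ n))
          (allFin⁺ n) (λ {i} _ → ∈-allFin i)
          (λ {i} _ → ≡.subst (_∈ map (σ⁻¹ σ perm) (allFin n)) (σ⁻¹∘σ σ perm i) (∈-map⁺ (σ⁻¹ σ perm) (∈-allFin (lookup σ i))))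

      weight-Ω : weight σ ≈ Ω n p
      weight-Ω = begin
        weight σ ≈⟨ weight-local σ ⟩
        ∏ (allFin n) (λ i → let v = toℕ i in local (s v) (t v) (rec v) (anti v) (cmin v) (nest v) v)
          ≈⟨ ∏-cong (allFin n) (λ i → local-split L (toℕ<n i)) ⟩
        ∏ (allFin n) (λ i → riseFactor p (toℕ i) * ownFall p (toℕ i)) ≈⟨ ∏-* (allFin n) _ _ ⟩
        ∏ (allFin n) (riseFactor p ∘ toℕ) * ∏ (allFin n) (ownFall p ∘ toℕ) ≈⟨ *-congˡ ∏-ownFall ⟩
        ∏ (allFin n) (riseFactor p ∘ toℕ) * ∏ (allFin n) (fallFactor p ∘ toℕ) ≈⟨ ∏-* (allFin n) _ _ ⟨
        ∏ (allFin n) (ω p ∘ toℕ) ≈⟨ ∏-allFin n (ω p) ⟩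
        Ω n p ∎

  Qtilde-jfrac : ∀ n → Qtilde x₁ x₂ ỹ₁ y₂ u₁ u₂ ṽ₁ v₂ w n ≈
                 jfracCoeff (gammaSeq x₂ y₂ u₂ v₂ w) (betaSeq x₁ ỹ₁ u₁ ṽ₁) n
  Qtilde-jfrac n = begin
    ∑ (perms n) weight              ≈⟨ ∑-cong (perms n) (λ σ σ∈ → weight-Ω σ (perms-isPerm σ∈)) ⟩
    ∑ (perms n) (λ σ → Ω n (view σ)) ≈⟨ ∑-map view (perms n) (Ω n) ⟨
    ∑ (views n) (Ω n)             ≈⟨ ∑-Ω n (views n) views-lawful leaf ⟩
    -- `betaSeq` at `suc k` is `a k * b k` by definition: a rise carries the factor of the new slot,
    -- a fall that of the image of a valley.
    paths γ a b n 0                 ≈⟨ paths-jfrac γ a b (betaSeq x₁ ỹ₁ u₁ ṽ₁) (λ _ → refl) n ⟩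
    jfracCoeff γ (betaSeq x₁ ỹ₁ u₁ ṽ₁) n ∎

theorem3p1 : ∀ {c ℓ} (R : CommutativeRing c ℓ)
    (x₁ x₂ ỹ₁ y₂ u₁ u₂ ṽ₁ v₂ : CommutativeRing.Carrier R)
    (w : ℕ → CommutativeRing.Carrier R) (n : ℕ) →
    CommutativeRing._≈_ R
    (RingDefs.Qtilde R x₁ x₂ ỹ₁ y₂ u₁ u₂ ṽ₁ v₂ w n)
    (RingDefs.jfracCoeff R
    (RingDefs.gammaSeq R x₂ y₂ u₂ v₂ w)
    (RingDefs.betaSeq R x₁ ỹ₁ u₁ ṽ₁) n)
theorem3p1 R x₁ x₂ ỹ₁ y₂ u₁ u₂ ṽ₁ v₂ w = Proof.Qtilde-jfrac R x₁ x₂ ỹ₁ y₂ u₁ u₂ ṽ₁ v₂ w
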